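{- Let $p$ be a prime, $p>3$, and let $c\in D_p$ with $c^2\not\equiv -3\pmod p$. Then \[ c\sum_{k=(p+1)/2}^{\lfloor 2p/3\rfloor}\binom{3k}{k}\left(\frac{4}{9(c^2+3)}\right)^k\equiv \begin{cases} 0 \pmod{p}, & \text{if } c\in C_0(p);\\ 1 \pmod{p}, & \text{if } c\in C_1(p);\\ -1 \pmod{p}, & \text{if } c\in C_2(p). \end{cases} \]
   Context: $D_p$ is the set of rationals whose denominator is not divisible by $p$. Let $\omega=e^{2\pi i/3}$ and $\mathbb{Z}[\omega]$ the Eisenstein integers, with norm $N(a+b\omega)=a^2-ab+b^2$. For a prime $\pi$ of $\mathbb{Z}[\omega]$ with $N(\pi)\neq 3$ and $\alpha\in\mathbb{Z}[\omega]$, the cubic residue character $\left(\frac{\alpha}{\pi}\right)_3$ is $0$ if $\pi\mid\alpha$, and otherwise is the unique $\omega^j$ ($j\in\{0,1,2\}$) with $\alpha^{(N(\pi)-1)/3}\equiv\omega^j\pmod{\pi}$. For a rational prime $p\equiv 2\pmod 3$, $p$ is prime in $\mathbb{Z}[\omega]$ and $\left(\frac{\alpha}{p}\right)_3$ is this character (with $N(p)=p^2$); for $p\equiv 1\pmod 3$, write $p=\pi\bar\pi$ with $\pi$ primary ($\pi\equiv 2\pmod 3$) and set $\left(\frac{\alpha}{p}\right)_3=\left(\frac{\alpha}{\pi}\right)_3\left(\frac{\alpha}{\bar\pi}\right)_3$ (cubic Jacobi symbol). Elements of $D_p$ are reduced modulo these primes in the natural way. For $j\in\{0,1,2\}$,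 $C_j(p)=\{c\in D_p : \left(\frac{c+1+2\omega}{p}\right)_3=\omega^j\}$. -}

module Defs where

open import Data.Nat as ℕ using (ℕ; zero; suc; _∸_)
open import Data.Nat.DivMod using (_/_; _%_)
open import Data.Nat.Combinatorics using (_C_)
open import Data.Integer as ℤ using (ℤ; +_; ∣_∣)
open import Data.Integer.Divisibility as ℤD using ()
open import Data.Nat.Divisibility as ℕD using ()
open import Data.Rational as ℚ using (ℚ; ↥_; ↧_; ↧ₙ_; 0ℚ; 1ℚ; _≟_; 1/_)

open import Data.Fin using (Fin; toℕ)
open import Data.List using (List; map; upTo; foldr)
open import Data.Product using (Σ; _×_; ∃₂)
open import Data.Sum using (_⊎_)
open import Relation.Nullary using (¬_; yes; no)
open import Relation.Binary.PropositionalEquality using (_≡_)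

-- inverse with the convention 0⁻¹ = 0 (only ever applied to nonzero values)
inv : ℚ → ℚ
inv x with x ≟ 0ℚ
... | yes _  = 0ℚ
... | no x≢0 = 1/_ x {{ℚ.≢-nonZero x≢0}}

infixr 8 _^ℚ_
_^ℚ_ : ℚ → ℕ → ℚ
x ^ℚ zero  = 1ℚ
x ^ℚ suc n = x ℚ.* (x ^ℚ n)

sumFromTo : ℕ → ℕ → (ℕ → ℚ) → ℚ
sumFromTo lo hi f = foldr ℚ._+_ 0ℚ (map (λ i → f (lo ℕ.+ i)) (upTo (suc hi ∸ lo)))

InD : ℕ → ℚ → Set
InD p c = ¬ (p ℕD.∣ ↧ₙ c)

-- x ≡ y (mod p) for x, y ∈ D_p : the numerator of x - y is divisible by p
infix 4 _≡_[modℚ_]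
_≡_[modℚ_] : ℚ → ℚ → ℕ → Set
x ≡ y [modℚ p ] = (+ p) ℤD.∣ (↥ (x ℚ.- y))

-- Eisenstein integers ℤ[ω], ω = e^{2πi/3}, ω² = -1 - ω

record ℤω : Set where
  constructor _+_ω
  field
    re : ℤ
    im : ℤ
open ℤω public

infixl 6 _+ω_ _-ω_
infixl 7 _*ω_

_+ω_ : ℤω → ℤω → ℤω
(a + b ω) +ω (c + d ω) = (a ℤ.+ c) + (b ℤ.+ d) ω

-ω_ : ℤω → ℤω
-ω (a + b ω) = (ℤ.- a) + (ℤ.- b) ω

_-ω_ : ℤω → ℤω → ℤω
x -ω y = x +ω (-ω y)

-- (a + bω)(c + dω) = ac + (ad + bc)ω + bd ω² = (ac - bd) + (ad + bc - bd)ω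
_*ω_ : ℤω → ℤω → ℤω
(a + b ω) *ω (c + d ω) = (a ℤ.* c ℤ.- b ℤ.* d) + (a ℤ.* d ℤ.+ b ℤ.* c ℤ.- b ℤ.* d) ω

embed : ℤ → ℤω
embed a = a + (+ 0) ω

ω : ℤω
ω = (+ 0) + (+ 1) ω

1ω : ℤω
1ω = embed (+ 1)

_^ω_ : ℤω → ℕ → ℤω
x ^ω zero  = 1ω
x ^ω suc n = x *ω (x ^ω n)

-- complex conjugate: conj(a + bω) = a + b ω̄ = (a - b) - bω
conj : ℤω → ℤω
conj (a + b ω) = (a ℤ.- b) + (ℤ.- b) ω

Nω : ℤω → ℤ
Nω (a + b ω) = a ℤ.* a ℤ.- a ℤ.* b ℤ.+ b ℤ.* b

_∣ω_ : ℤω → ℤω → Set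
π ∣ω α = Σ ℤω (λ γ → α ≡ π *ω γ)

Primary : ℤω → Set
Primary π = embed (+ 3) ∣ω (π -ω embed (+ 2))

-- For a prime π (N(π) ≠ 3), α ∈ ℤ[ω] and a rational integer β with π ∤ β,
-- CubicChar π α β j  means  (α/β mod π)^{(N(π)-1)/3} ≡ ω^j (mod π),
-- i.e. (α·β⁻¹)^{(N(π)-1)/3} ≡ ω^j, written without inverses as
-- α^{(N(π)-1)/3} ≡ ω^j · β^{(N(π)-1)/3} (mod π).
-- In other words (α/β over π)_3 = ω^j.
CubicChar : ℤω → ℤω → ℤ → Fin 3 → Set
CubicChar π α β j =
  π ∣ω ((α ^ω e) -ω ((ω ^ω toℕ j) *ω (embed β ^ω e)))
  where
  e : ℕ
  e = (∣ Nω π ∣ ∸ 1) / 3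

-- c + 1 + 2ω for c = a/b ∈ D_p is represented by the pair
-- numerator (a + b) + 2b ω, rational denominator b.
shiftNum : ℚ → ℤω
shiftNum c = (↥ c ℤ.+ ↧ c) + (+ 2 ℤ.* ↧ c) ω

-- c ∈ C_j(p) :  ((c + 1 + 2ω)/p)_3 = ω^j
InC : ℕ → ℚ → Fin 3 → Set
InC p c j =
  (p % 3 ≡ 2 × CubicChar (embed (+ p)) (shiftNum c) (↧ c) j)
  ⊎
  (p % 3 ≡ 1 × Σ ℤω λ π → Primary π × (π *ω conj π ≡ embed (+ p)) ×
     ∃₂ λ (i k : Fin 3) → CubicChar π (shiftNum c) (↧ c) i
                        × CubicChar (conj π) (shiftNum c) (↧ c) k
                        × ((toℕ i ℕ.+ toℕ k) % 3 ≡ toℕ j))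

theSum : ℕ → ℚ → ℚ
theSum p c =
  c ℚ.* sumFromTo ((p ℕ.+ 1) / 2) ((2 ℕ.* p) / 3)
          (λ k → (ℤ.+ ((3 ℕ.* k) C k) ℚ./ 1) ℚ.* (x ^ℚ k))
  where
  x : ℚ
  x = (ℤ.+ 4 ℚ./ 1) ℚ.* inv ((ℤ.+ 9 ℚ./ 1) ℚ.* (c ℚ.* c ℚ.+ (ℤ.+ 3 ℚ./ 1)))

{-# OPTIONS --safe #-}
-- Write p = 6h - ε with ε = ± 1, and let α = c + √-3, β = c - √-3, N = αβ = c² + 3.
-- For k = (p + 1)/2 + j a comparison of falling factorials gives
-- C(3k, k) ≡ 9 ε (-27)^j C(h + j, 2j + 1) (mod p), so the sum becomes a multiple of
-- Σ_j C(h + j, 2j + 1) y^j with y = -12/N = (α - β)²/(αβ), which is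
-- (α^(2h) - β^(2h)) / (α² - β²) up to a power of N.  Hence
-- N^((p-1)/2 + h) √-3 · (c Σ) ≡ ε (α^(2h) - β^(2h)).
-- If ε = -1, then 2h = (p - 1)/3 and α^(2h), β^(2h) are powers of ω modulo π; if ε = 1, then
-- α^p ≡ β and the cubic character of α is (β/α)^(2h).  Either way c Σ · √-3 ≡ ω^l - ω^(-l) for c ∈ C_l(p).
module Submission where

-- The mixfix form a + b ω makes sums of integers ambiguous to parse.
open import Defs renaming (_+_ω to eisenstein)

-- The range of summation is the support of the new binomials: ⌊2p/3⌋ = (p - 1)/2 + h in both
-- residue classes, so j runs over 0 ≤ j < h, and C(h + j, 2j + 1) is nonzero for exactly these j.
-- This is why a truncated sum has a closed form. The binomials can be exchanged because 3k = p + n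
-- with n = k + m, m = 2j + 1. Dropping p and using symmetry leaves C(n, m) with n ≡ (6j + 3)/2, to
-- be compared with C(h + j, m), where h + j ≡ (6j + ε)/6. The factor c takes the place of a
-- division: the closed form carries α² - β² = 4c√-3, which c Σ supplies, so c ≡ 0 is no special
-- case. The power N^((p+1)/2) hides the quadratic character of N. It is never evaluated: the power
-- of αβ is carried along until it meets α^(2h) β^(2h). Congruences stay multiplied out, and only
-- rational integers prime to p are cancelled. A last factor √-3 turns the result into -3 c Σ ≡ -3 r
-- between integers, which descends from π to p.

module PrimeBinomials where
  open import Data.Nat using (zero; suc; _+_; _*_; _<_; _!; s≤s; nonTrivial⇒n>1)
  open import Data.Nat.Properties using (+-comm; *-zeroʳ; *-distribˡ-+; <-trans; n<1+n)
  open import Data.Nat.Combinatorics using (_C_; nCk+nC[k+1]≡[n+1]C[k+1])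
  open import Data.Nat.Divisibility using (_∣_; _∤_; >⇒∤; m∣m*n)
  open import Data.Nat.Primality using (Prime; euclidsLemma; prime⇒nonTrivial)
  open import Data.Nat.Tactic.RingSolver using (solve-∀)
  open import Data.Sum using ([_,_]′)
  open import Function using (id)
  open import Relation.Nullary using (contradiction)
  open import Relation.Binary.PropositionalEquality

  C-absorption : ∀ n k → suc k * (suc n C suc k) ≡ suc n * (n C k)
  C-absorption zero    zero    = refl
  C-absorption zero    (suc k) = *-zeroʳ (suc (suc k))
  C-absorption (suc n) zero    = begin
    1 * (suc (suc n) C 1)              ≡⟨ cong (1 *_) (nCk+nC[k+1]≡[n+1]C[k+1] (suc n) 0) ⟨
    1 * ((suc n C 0) + (suc n C 1))    ≡⟨ *-distribˡ-+ 1 (suc n C 0) (suc n C 1) ⟩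
    1 + 1 * (suc n C 1)                ≡⟨ cong (1 +_) (C-absorption n 0) ⟩
    1 + suc n * 1                      ∎
    where open ≡-Reasoning
  C-absorption (suc n) (suc k) = begin
    (2 + k) * (suc (suc n) C suc (suc k))
      ≡⟨ cong ((2 + k) *_) (nCk+nC[k+1]≡[n+1]C[k+1] (suc n) (suc k)) ⟨
    (2 + k) * (a + (suc n C suc (suc k)))
      ≡⟨ *-distribˡ-+ (2 + k) a _ ⟩
    (2 + k) * a + (2 + k) * (suc n C suc (suc k))
      ≡⟨ cong₂ _+_ (+-comm a (suc k * a)) (C-absorption n (suc k)) ⟩
    (suc k * a + a) + suc n * (n C suc k)
      ≡⟨ cong (λ x → (x + a) + suc n * (n C suc k)) (C-absorption n k) ⟩
    (suc n * (n C k) + a) + suc n * (n C suc k)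
      ≡⟨ rearrange n (n C k) a (n C suc k) ⟩
    suc n * ((n C k) + (n C suc k)) + a
      ≡⟨ cong (λ x → suc n * x + a) (nCk+nC[k+1]≡[n+1]C[k+1] n k) ⟩
    suc n * a + a
      ≡⟨ +-comm (suc n * a) a ⟩
    (2 + n) * a ∎
    where
    open ≡-Reasoning
    a = suc n C suc k
    rearrange : ∀ n x y z → (suc n * x + y) + suc n * z ≡ suc n * (x + z) + y
    rearrange = solve-∀

  module _ {p} (p-prime : Prime p) where

    ∤-* : ∀ {m n} → p ∤ m → p ∤ n → p ∤ m * n
    ∤-* {m} {n} p∤m p∤n p∣mn = [ p∤m , p∤n ]′ (euclidsLemma m n p-prime p∣mn)

    ∤-! : ∀ {n} → n < p → p ∤ n !
    ∤-! {zero}  0<p = >⇒∤ (nonTrivial⇒n>1 p {{prime⇒nonTrivial p-prime}})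
    ∤-! {suc n} n<p = ∤-* (>⇒∤ n<p) (∤-! (<-trans (n<1+n n) n<p))

  -- By absorption the coefficient times k + 1 is a multiple of the prime, which cannot divide the
  -- smaller positive number k + 1.
  p∣pC[1+k] : ∀ {p} → Prime (suc p) → ∀ {k} → k < p → suc p ∣ (suc p C suc k)
  p∣pC[1+k] {p} p-prime {k} k<p =
    [ (λ p∣k → contradiction p∣k (>⇒∤ (s≤s k<p))) , id ]′
    (euclidsLemma (suc k) (suc p C suc k) p-prime
      (subst (suc p ∣_) (sym (C-absorption p k)) (m∣m*n (p C k))))

-- Quotients of commutative rings by a principal ideal.

module Quotients where
  open PrimeBinomials
  open import Algebra.Bundles using (CommutativeRing)
  open import Data.Fin as Fin using ()
  open import Data.Fin.Properties using (toℕ<n; toℕ-fromℕ; toℕ-inject₁)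
  open import Data.Nat as ℕ using (zero; suc)
  open import Data.Nat.Combinatorics using (nCn≡1)
  open import Data.Nat.Divisibility using (_∣_; divides)
  open import Data.Nat.Primality using (Prime; prime)
  open import Data.Nat.Properties as ℕ using ()
  open import Data.Product using (Σ; _,_)
  open import Level using (_⊔_)
  open import Relation.Binary.PropositionalEquality as ≡ using ()

  module Quotient {c ℓ} (R : CommutativeRing c ℓ) (m : CommutativeRing.Carrier R) where
    open CommutativeRing R
    open import Algebra.Properties.Ring ring
    open import Algebra.Properties.AbelianGroup +-abelianGroup using (⁻¹-∙-comm)
    open import Relation.Binary.Reasoning.Setoid setoid

    -- Over ℤ[ω] this unfolds to `_∣ω_`, so the character hypotheses are congruences as they stand.
    Multiple : Carrier → Set (c ⊔ ℓ)
    Multiple x = Σ Carrier λ γ → x ≈ m * γ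

    Multiple-resp : ∀ {x y} → y ≈ x → Multiple x → Multiple y
    Multiple-resp y≈x (γ , x≈mγ) = γ , trans y≈x x≈mγ

    Multiple-+ : ∀ {x y} → Multiple x → Multiple y → Multiple (x + y)
    Multiple-+ (γ , x≈mγ) (δ , y≈mδ) = γ + δ , trans (+-cong x≈mγ y≈mδ) (sym (distribˡ m γ δ))

    Multiple-neg : ∀ {x} → Multiple x → Multiple (- x)
    Multiple-neg (γ , x≈mγ) = - γ , trans (-‿cong x≈mγ) (-‿distribʳ-* m γ)

    Multiple-*ʳ : ∀ {x} y → Multiple x → Multiple (x * y)
    Multiple-*ʳ y (γ , x≈mγ) = γ * y , trans (*-congʳ x≈mγ) (*-assoc m γ y)

    Multiple-*ˡ : ∀ {x} y → Multiple x → Multiple (y * x)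
    Multiple-*ˡ {x} y mx = Multiple-resp (*-comm y x) (Multiple-*ʳ y mx)

    infix 4 _≋_
    -- A record rather than a synonym for `Multiple (x - y)`, which keeps x and y visible to
    -- unification.
    record _≋_ (x y : Carrier) : Set (c ⊔ ℓ) where
      constructor from-multiple
      field to-multiple : Multiple (x - y)
    open _≋_ public

    ≋-reflexive : ∀ {x y} → x ≈ y → x ≋ y
    ≋-reflexive {x} {y} x≈y = from-multiple (0# , (begin
      x - y  ≈⟨ +-congʳ x≈y ⟩
      y - y  ≈⟨ -‿inverseʳ y ⟩
      0#     ≈⟨ zeroʳ m ⟨
      m * 0# ∎))

    ≋-refl : ∀ {x} → x ≋ x
    ≋-refl = ≋-reflexive refl

    private
      telescope : ∀ x y z → x - z ≈ (x - y) + (y - z)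
      telescope x y z = begin
        x - z               ≈⟨ +-congʳ (+-identityʳ x) ⟨
        x + 0# - z          ≈⟨ +-congʳ (+-congˡ (-‿inverseˡ y)) ⟨
        x + (- y + y) - z   ≈⟨ +-congʳ (+-assoc x (- y) y) ⟨
        x - y + y - z       ≈⟨ +-assoc (x - y) y (- z) ⟩
        (x - y) + (y - z)   ∎

      neg-difference : ∀ x y → y - x ≈ - (x - y)
      neg-difference x y = begin
        y - x          ≈⟨ +-comm y (- x) ⟩
        - x + y        ≈⟨ +-congˡ (-‿involutive y) ⟨
        - x + - - y    ≈⟨ ⁻¹-∙-comm x (- y) ⟩
        - (x - y)      ∎

    ≋-sym : ∀ {x y} → x ≋ y → y ≋ x
    ≋-sym {x} {y} (from-multiple d) = from-multiple (Multiple-resp (neg-difference x y) (Multiple-neg d))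

    ≋-trans : ∀ {x y z} → x ≋ y → y ≋ z → x ≋ z
    ≋-trans {x} {y} {z} (from-multiple d) (from-multiple e) =
      from-multiple (Multiple-resp (telescope x y z) (Multiple-+ d e))

    ≋-+-cong : ∀ {x y u v} → x ≋ y → u ≋ v → x + u ≋ y + v
    ≋-+-cong {x} {y} {u} {v} (from-multiple d) (from-multiple e) = from-multiple (Multiple-resp (begin
      x + u - (y + v)            ≈⟨ +-congˡ (⁻¹-∙-comm y v) ⟨
      (x + u) + (- y + - v)      ≈⟨ +-assoc x u _ ⟩
      x + (u + (- y + - v))      ≈⟨ +-congˡ (+-assoc u (- y) (- v)) ⟨
      x + ((u + - y) + - v)      ≈⟨ +-congˡ (+-congʳ (+-comm u (- y))) ⟩
      x + ((- y + u) + - v)      ≈⟨ +-congˡ (+-assoc (- y) u (- v)) ⟩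
      x + (- y + (u - v))        ≈⟨ +-assoc x (- y) (u - v) ⟨
      (x - y) + (u - v)          ∎) (Multiple-+ d e))

    ≋-neg-cong : ∀ {x y} → x ≋ y → - x ≋ - y
    ≋-neg-cong {x} {y} (from-multiple d) = from-multiple (Multiple-resp (⁻¹-∙-comm x (- y)) (Multiple-neg d))

    ≋-*-cong : ∀ {x y u v} → x ≋ y → u ≋ v → x * u ≋ y * v
    ≋-*-cong {x} {y} {u} {v} (from-multiple d) (from-multiple e) = from-multiple (Multiple-resp (begin
      x * u - y * v                        ≈⟨ telescope (x * u) (y * u) (y * v) ⟩
      (x * u - y * u) + (y * u - y * v)    ≈⟨ +-cong ([y-z]x≈yx-zx u x y) (x[y-z]≈xy-xz y u v) ⟨
      (x - y) * u + y * (u - v)            ∎) (Multiple-+ (Multiple-*ʳ u d) (Multiple-*ˡ y e)))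

    quotientRing : CommutativeRing c (c ⊔ ℓ)
    quotientRing = record
      { Carrier = Carrier ; _≈_ = _≋_ ; _+_ = _+_ ; _*_ = _*_ ; -_ = -_ ; 0# = 0# ; 1# = 1#
      ; isCommutativeRing = record
        { isRing = record
          { +-isAbelianGroup = record
            { isGroup = record
              { isMonoid = record
                { isSemigroup = record
                  { isMagma = record
                    { isEquivalence = record { refl = ≋-reflexive refl ; sym = ≋-sym ; trans = ≋-trans }
                    ; ∙-cong = ≋-+-cong }
                  ; assoc = λ x y z → ≋-reflexive (+-assoc x y z) }
                ; identity = (λ x → ≋-reflexive (+-identityˡ x)) , (λ x → ≋-reflexive (+-identityʳ x)) }
              ; inverse = (λ x → ≋-reflexive (-‿inverseˡ x)) , (λ x → ≋-reflexive (-‿inverseʳ x))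
              ; ⁻¹-cong = ≋-neg-cong }
            ; comm = λ x y → ≋-reflexive (+-comm x y) }
          ; *-cong = ≋-*-cong
          ; *-assoc = λ x y z → ≋-reflexive (*-assoc x y z)
          ; *-identity = (λ x → ≋-reflexive (*-identityˡ x)) , (λ x → ≋-reflexive (*-identityʳ x))
          ; distrib = (λ x y z → ≋-reflexive (distribˡ x y z)) , (λ x y z → ≋-reflexive (distribʳ x y z)) }
        ; *-comm = λ x y → ≋-reflexive (*-comm x y) } }

    module ≋-Reasoning where
      open import Relation.Binary.Reasoning.Setoid (CommutativeRing.setoid quotientRing) public

  -- The Frobenius map and Fermat's theorem in rings with p = 0.

  module Frobenius {c ℓ} (K : CommutativeRing c ℓ) where
    open CommutativeRing K
    open import Algebra.Properties.Semiring.Exp semiring public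
    open import Algebra.Properties.Semiring.Mult semiring public
    open import Algebra.Properties.CommutativeSemiring.Binomial commutativeSemiring
    open import Algebra.Properties.Semiring.Sum semiring
    open import Data.Vec.Functional using (Vector; tail; init; last)
    open import Relation.Binary.Reasoning.Setoid setoid

    1^n≈1 : ∀ n → 1# ^ n ≈ 1#
    1^n≈1 zero    = refl
    1^n≈1 (suc n) = trans (*-identityˡ _) (1^n≈1 n)

    module _ {p} (p-prime : Prime p) (p×1≈0 : p × 1# ≈ 0#) where

      p∣n⇒n×x≈0 : ∀ {n} x → p ∣ n → n × x ≈ 0#
      p∣n⇒n×x≈0 x (divides q ≡.refl) = begin
        (q ℕ.* p) × x          ≈⟨ ×-congˡ (ℕ.*-comm q p) ⟩
        (p ℕ.* q) × x          ≈⟨ ×-assocˡ x p q ⟨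
        p × (q × x)            ≈⟨ ×-congʳ p (*-identityˡ (q × x)) ⟨
        p × (1# * (q × x))     ≈⟨ ×-assoc-* p 1# (q × x) ⟨
        (p × 1#) * (q × x)     ≈⟨ *-congʳ p×1≈0 ⟩
        0# * (q × x)           ≈⟨ zeroˡ _ ⟩
        0#                     ∎

    -- All inner terms of the binomial theorem are multiples of p. The general ring serves two uses:
    -- ℤ modulo p, for Fermat's theorem, and ℤ[ω] modulo an inert p, where α^p ≡ β.
    frobenius-+ : ∀ {p} → Prime p → p × 1# ≈ 0# → ∀ x y → (x + y) ^ p ≈ x ^ p + y ^ p
    frobenius-+ {zero}  (prime {{()}} _)
    frobenius-+ {suc p} p-prime p×1≈0 x y = begin
      (x + y) ^ suc p                                ≈⟨ theorem (suc p) x y ⟩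
      t Fin.zero + sum (tail t)                      ≈⟨ +-congˡ (sum-init-last (tail t)) ⟩
      t Fin.zero + (sum (init (tail t)) + last (tail t))
        ≈⟨ +-cong first (trans (+-cong middle final) (+-identityˡ _)) ⟩
      y ^ suc p + x ^ suc p                          ≈⟨ +-comm _ _ ⟩
      x ^ suc p + y ^ suc p                          ∎
      where
      t : Vector Carrier (suc (suc p))
      t = binomialTerm x y (suc p)
      first : t Fin.zero ≈ y ^ suc p
      first = trans (+-identityʳ _) (*-identityˡ _)
      middle : sum (init (tail t)) ≈ 0#
      middle = trans (sum-cong-≋ (λ i → p∣n⇒n×x≈0 p-prime p×1≈0 _
                 (p∣pC[1+k] p-prime (≡.subst (ℕ._< p) (≡.sym (toℕ-inject₁ i)) (toℕ<n i)))))
                 (sum-replicate-zero p)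
      final : last (tail t) ≈ x ^ suc p
      final rewrite toℕ-fromℕ p | nCn≡1 (suc p) | ℕ.n∸n≡0 p =
        trans (+-identityʳ _) (*-identityʳ _)

    fermat : ∀ {p} → Prime p → p × 1# ≈ 0# → ∀ n → (n × 1#) ^ p ≈ n × 1#
    fermat {zero}  (prime {{()}} _)
    fermat {suc p} p-prime p×1≈0 zero    = zeroˡ _
    fermat {suc p} p-prime p×1≈0 (suc n) =
      trans (frobenius-+ p-prime p×1≈0 1# (n × 1#)) (+-cong (1^n≈1 (suc p)) (fermat p-prime p×1≈0 n))

module CubicSums where
  open PrimeBinomials
  open Quotients
  open import Algebra.Bundles using (CommutativeRing)
  open import Data.Fin using (toℕ)
  open import Data.Fin.Patterns using (0F; 1F; 2F)
  open import Data.Integer using (ℤ; +_; +[1+_]; -[1+_]; 0ℤ; 1ℤ; _+_; _*_; _-_; -_; _^_; ∣_∣)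
  open import Data.Integer.Divisibility using () renaming (_∣_ to _∣ℤ_)
  open import Data.Integer.Divisibility.Signed using (divides; ∣ᵤ⇒∣; ∣⇒∣ᵤ)
  open import Data.Integer.DivMod using (_%ℕ_; _/ℕ_; a≡a%ℕn+[a/ℕn]*n)
  open import Data.Integer.Properties using (+-*-commutativeRing; pos-+; pos-*; abs-*; *-comm; *-identityˡ; *-identityʳ; *-zeroʳ; +-identityʳ; ^-distribˡ-+-*; ^-*-assoc)
  open import Data.Integer.Tactic.RingSolver using (solve-∀)
  open import Data.List using (foldr; map; applyUpTo)
  open import Data.Maybe using (just; nothing)
  open import Data.Nat as ℕ using (ℕ; zero; suc; _!; s≤s; z≤n; _>_; nonTrivial⇒n>1)
  open import Data.Nat.Combinatorics using (_C_; nCk≡nC[n∸k]; nCk+nC[k+1]≡[n+1]C[k+1]; k>n⇒nCk≡0)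
  open import Data.Nat.Divisibility using (>⇒∤; divides-refl) renaming (_∣_ to _ℕ∣_)
  open import Data.Nat.DivMod using (m*n/n≡m; m≡m%n+[m/n]*n; +-distrib-/-∣ʳ)
  open import Data.Nat.Primality using (Prime; euclidsLemma; prime⇒nonZero; prime⇒nonTrivial; prime⇒irreducible)
  open import Data.Nat.Properties as ℕ using ()
  import Data.Nat.Tactic.RingSolver as ℕ-Solver
  open import Data.Product using (_,_; ∃; proj₁; proj₂)
  open import Data.Rational as ℚ using (ℚ; mkℚ; 0ℚ; ↥_; ↧_; toℚᵘ; _≟_)
  open import Data.Rational.Properties using (toℚᵘ-homo-+; toℚᵘ-homo-*; toℚᵘ-homo‿-; toℚᵘ-fromℚᵘ)
  open import Data.Rational.Unnormalised as ℚᵘ using (mkℚᵘ; _≃_; *≡*)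
  import Data.Rational.Unnormalised.Properties as ℚᵘ
  open import Data.Sum as Sum using (_⊎_; inj₁; inj₂; [_,_]′)
  open import Function using (_∘_; id)
  open import Level using (0ℓ)
  open import Relation.Binary.PropositionalEquality
  open import Relation.Nullary using (¬_; contradiction; yes; no)
  open import Tactic.RingSolver using () renaming (solve-∀ to solveω-∀)
  open import Tactic.RingSolver.Core.AlmostCommutativeRing using (AlmostCommutativeRing; fromCommutativeRing)

  -- The Eisenstein integers as a commutative ring.

  ℤω-commutativeRing : CommutativeRing 0ℓ 0ℓ
  ℤω-commutativeRing = record
    { Carrier = ℤω ; _≈_ = _≡_ ; _+_ = _+ω_ ; _*_ = _*ω_ ; -_ = -ω_ ; 0# = embed 0ℤ ; 1# = 1ω
    ; isCommutativeRing = record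
      { isRing = record
        { +-isAbelianGroup = record
          { isGroup = record
            { isMonoid = record
              { isSemigroup = record
                { isMagma = record { isEquivalence = isEquivalence ; ∙-cong = cong₂ _+ω_ }
                ; assoc = λ x y z → cong₂ eisenstein (r-assoc (re x) (re y) (re z)) (r-assoc (im x) (im y) (im z)) }
              ; identity = (λ x → cong₂ eisenstein (r-idˡ (re x)) (r-idˡ (im x))) , (λ x → cong₂ eisenstein (r-idʳ (re x)) (r-idʳ (im x))) }
            ; inverse = (λ x → cong₂ eisenstein (r-invˡ (re x)) (r-invˡ (im x))) , (λ x → cong₂ eisenstein (r-invʳ (re x)) (r-invʳ (im x)))
            ; ⁻¹-cong = cong (λ x → -ω x) }
          ; comm = λ x y → cong₂ eisenstein (r-comm (re x) (re y)) (r-comm (im x) (im y)) }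
        ; *-cong = cong₂ _*ω_
        ; *-assoc = λ { (eisenstein a b) (eisenstein c d) (eisenstein e f) → cong₂ eisenstein (a₁ a b c d e f) (a₂ a b c d e f) }
        ; *-identity = (λ { (eisenstein a b) → cong₂ eisenstein (i₁ a b) (i₂ a b) })
                     , (λ { (eisenstein a b) → cong₂ eisenstein (i₃ a b) (i₄ a b) })
        ; distrib = (λ { (eisenstein a b) (eisenstein c d) (eisenstein e f) → cong₂ eisenstein (d₁ a b c d e f) (d₂ a b c d e f) })
                  , (λ { (eisenstein a b) (eisenstein c d) (eisenstein e f) → cong₂ eisenstein (d₃ a b c d e f) (d₄ a b c d e f) }) }
      ; *-comm = λ { (eisenstein a b) (eisenstein c d) → cong₂ eisenstein (c₁ a b c d) (c₂ a b c d) } } }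
    where
    r-assoc : ∀ x y z → x + y + z ≡ x + (y + z)
    r-assoc = solve-∀
    r-idˡ : ∀ x → 0ℤ + x ≡ x
    r-idˡ = solve-∀
    r-idʳ : ∀ x → x + 0ℤ ≡ x
    r-idʳ = solve-∀
    r-invˡ : ∀ x → - x + x ≡ 0ℤ
    r-invˡ = solve-∀
    r-invʳ : ∀ x → x + - x ≡ 0ℤ
    r-invʳ = solve-∀
    r-comm : ∀ x y → x + y ≡ y + x
    r-comm = solve-∀
    a₁ : ∀ a b c d e f → (a * c - b * d) * e - (a * d + b * c - b * d) * f ≡ a * (c * e - d * f) - b * (c * f + d * e - d * f)
    a₁ = solve-∀
    a₂ : ∀ a b c d e f → (a * c - b * d) * f + (a * d + b * c - b * d) * e - (a * d + b * c - b * d) * f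
       ≡ a * (c * f + d * e - d * f) + b * (c * e - d * f) - b * (c * f + d * e - d * f)
    a₂ = solve-∀
    i₁ : ∀ a b → + 1 * a - + 0 * b ≡ a
    i₁ = solve-∀
    i₂ : ∀ a b → + 1 * b + + 0 * a - + 0 * b ≡ b
    i₂ = solve-∀
    i₃ : ∀ a b → a * + 1 - b * + 0 ≡ a
    i₃ = solve-∀
    i₄ : ∀ a b → a * + 0 + b * + 1 - b * + 0 ≡ b
    i₄ = solve-∀
    d₁ : ∀ a b c d e f → a * (c + e) - b * (d + f) ≡ (a * c - b * d) + (a * e - b * f)
    d₁ = solve-∀
    d₂ : ∀ a b c d e f → a * (d + f) + b * (c + e) - b * (d + f) ≡ (a * d + b * c - b * d) + (a * f + b * e - b * f)
    d₂ = solve-∀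
    d₃ : ∀ a b c d e f → (c + e) * a - (d + f) * b ≡ (c * a - d * b) + (e * a - f * b)
    d₃ = solve-∀
    d₄ : ∀ a b c d e f → (c + e) * b + (d + f) * a - (d + f) * b ≡ (c * b + d * a - d * b) + (e * b + f * a - f * b)
    d₄ = solve-∀
    c₁ : ∀ a b c d → a * c - b * d ≡ c * a - d * b
    c₁ = solve-∀
    c₂ : ∀ a b c d → a * d + b * c - b * d ≡ c * b + d * a - d * b
    c₂ = solve-∀

  -- The zero test recognises the literal zero only, which is enough for the solver to discard
  -- cancelled coefficients.
  ωring : AlmostCommutativeRing 0ℓ 0ℓ
  ωring = fromCommutativeRing ℤω-commutativeRing
    λ { (eisenstein (+ 0) (+ 0)) → just refl ; _ → nothing }

  -- Integer powers and falling factorials with arbitrary step.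

  ^-distribʳ-* : ∀ x y n → (x * y) ^ n ≡ x ^ n * y ^ n
  ^-distribʳ-* x y zero    = refl
  ^-distribʳ-* x y (suc n) = trans (cong (x * y *_) (^-distribʳ-* x y n)) (interchange x y (x ^ n) (y ^ n))
    where
    interchange : ∀ x y u v → x * y * (u * v) ≡ x * u * (y * v)
    interchange = solve-∀

  -- Formally s^n · n! · C(a/s, n): a binomial coefficient with fractional upper entry, cleared of
  -- denominators.
  falling : ℤ → ℤ → ℕ → ℤ
  falling a s zero    = 1ℤ
  falling a s (suc n) = a * falling (a - s) s n

  -- The recursion peels factors off the top; the induction in `falling-2-6` changes the products at
  -- the bottom as well.
  falling-last : ∀ a s n → falling a s (suc n) ≡ falling a s n * (a - s * + n)
  falling-last a s zero    = base a s
    where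
    base : ∀ a s → a * 1ℤ ≡ 1ℤ * (a - s * + 0)
    base = solve-∀
  falling-last a s (suc n) = trans (cong (a *_) (falling-last (a - s) s n)) (step a s (falling (a - s) s n) (+ n))
    where
    step : ∀ a s f n → a * (f * (a - s - s * n)) ≡ a * f * (a - s * (+ 1 + n))
    step = solve-∀

  falling-scale : ∀ u a s n → u ^ n * falling a s n ≡ falling (u * a) (u * s) n
  falling-scale u a s zero    = refl
  falling-scale u a s (suc n) = begin
    u * u ^ n * (a * falling (a - s) s n)             ≡⟨ interchange u (u ^ n) a (falling (a - s) s n) ⟩
    u * a * (u ^ n * falling (a - s) s n)             ≡⟨ cong (u * a *_) (falling-scale u (a - s) s n) ⟩
    u * a * falling (u * (a - s)) (u * s) n           ≡⟨ cong (λ b → u * a * falling b (u * s) n) (distrib u a s) ⟩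
    u * a * falling (u * a - u * s) (u * s) n         ∎
    where
    open ≡-Reasoning
    interchange : ∀ u v a f → u * v * (a * f) ≡ u * a * (v * f)
    interchange = solve-∀
    distrib : ∀ u a s → u * (a - s) ≡ u * a - u * s
    distrib = solve-∀

  k!*nCk≡falling : ∀ n k → + (k !) * + (n C k) ≡ falling (+ n) 1ℤ k
  k!*nCk≡falling n       zero    = refl
  k!*nCk≡falling zero    (suc k) = zeroʳ (+ (suc k !))
    where
    zeroʳ : ∀ x → x * 0ℤ ≡ 0ℤ
    zeroʳ = solve-∀
  k!*nCk≡falling (suc n) (suc k) = begin
    + (suc k ℕ.* k !) * + (suc n C suc k)        ≡⟨ cong (_* + (suc n C suc k)) (pos-* (suc k) (k !)) ⟩
    + suc k * + (k !) * + (suc n C suc k)        ≡⟨ swap (+ suc k) (+ (k !)) _ ⟩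
    + (k !) * (+ suc k * + (suc n C suc k))      ≡⟨ cong (+ (k !) *_) (pos-* (suc k) _) ⟨
    + (k !) * + (suc k ℕ.* (suc n C suc k))      ≡⟨ cong (λ x → + (k !) * + x) (C-absorption n k) ⟩
    + (k !) * + (suc n ℕ.* (n C k))              ≡⟨ cong (+ (k !) *_) (pos-* (suc n) _) ⟩
    + (k !) * (+ suc n * + (n C k))              ≡⟨ swap′ (+ (k !)) (+ suc n) _ ⟩
    + suc n * (+ (k !) * + (n C k))              ≡⟨ cong (+ suc n *_) (k!*nCk≡falling n k) ⟩
    + suc n * falling (+ n) 1ℤ k                 ∎
    where
    open ≡-Reasoning
    swap : ∀ x y z → x * y * z ≡ y * (x * z)
    swap = solve-∀
    swap′ : ∀ x y z → x * (y * z) ≡ y * (x * z)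
    swap′ = solve-∀

  -- Both sides are multiplied by 3 (6j + 5)(6j + 7) when j grows by one.
  falling-2-6 : ∀ {ε} → ε * ε ≡ 1ℤ → ∀ j →
    falling (+ 6 * + j + + 3) (+ 2) (suc (j ℕ.* 2))
    ≡ + 3 * ε * (- + 3) ^ j * falling (+ 6 * + j + ε) (+ 6) (suc (j ℕ.* 2))
  falling-2-6 {ε} ε²≡1 zero    = begin
    + 3                                        ≡⟨⟩
    + 3 * 1ℤ                                   ≡⟨ cong (+ 3 *_) ε²≡1 ⟨
    + 3 * (ε * ε)                              ≡⟨ base ε ⟩
    + 3 * ε * 1ℤ * ((+ 0 + ε) * 1ℤ)            ∎
    where
    open ≡-Reasoning
    base : ∀ ε → + 3 * (ε * ε) ≡ + 3 * ε * 1ℤ * ((+ 0 + ε) * 1ℤ)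
    base = solve-∀
  falling-2-6 {ε} ε²≡1 (suc j) = begin
    a * ((a - + 2) * ((a - + 2 - + 2) * falling (a - + 2 - + 2 - + 2) (+ 2) (j ℕ.* 2)))
      ≡⟨ cong (λ b → a * ((a - + 2) * ((a - + 2 - + 2) * falling b (+ 2) (j ℕ.* 2)))) (a-6 (+ j)) ⟩
    a * ((a - + 2) * ((a - + 2 - + 2) * G))
      ≡⟨ left (+ j) G ⟩
    + 3 * (w * w - 1ℤ) * (G * (+ 6 * + j + + 3 - + 2 * (+ j * + 2)))
      ≡⟨ cong (λ x → + 3 * (w * w - 1ℤ) * (G * (+ 6 * + j + + 3 - + 2 * x))) (pos-* j 2) ⟨
    + 3 * (w * w - 1ℤ) * (G * (+ 6 * + j + + 3 - + 2 * + (j ℕ.* 2)))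
      ≡⟨ cong (+ 3 * (w * w - 1ℤ) *_) (trans (sym (falling-last (+ 6 * + j + + 3) (+ 2) (j ℕ.* 2))) (falling-2-6 {ε} ε²≡1 j)) ⟩
    + 3 * (w * w - 1ℤ) * (+ 3 * ε * t * Q)
      ≡⟨ cong (λ x → + 3 * (w * w - x) * (+ 3 * ε * t * Q)) ε²≡1 ⟨
    + 3 * (w * w - ε * ε) * (+ 3 * ε * t * Q)
      ≡⟨ right ε (+ j) t Q ⟩
    + 3 * ε * (- + 3 * t) * (b * Q * (b - + 6 * (+ 2 + + j * + 2)))
      ≡⟨ cong (λ x → + 3 * ε * (- + 3 * t) * (b * Q * (b - + 6 * (+ 2 + x)))) (pos-* j 2) ⟨
    + 3 * ε * (- + 3 * t) * (b * Q * (b - + 6 * + (2 ℕ.+ j ℕ.* 2)))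
      ≡⟨ cong (λ x → + 3 * ε * (- + 3 * t) * (b * falling x (+ 6) (suc (j ℕ.* 2)) * (b - + 6 * + (2 ℕ.+ j ℕ.* 2)))) (b-6 ε (+ j)) ⟨
    + 3 * ε * (- + 3 * t) * (falling b (+ 6) (2 ℕ.+ j ℕ.* 2) * (b - + 6 * + (2 ℕ.+ j ℕ.* 2)))
      ≡⟨ cong (+ 3 * ε * (- + 3 * t) *_) (falling-last b (+ 6) (2 ℕ.+ j ℕ.* 2)) ⟨
    + 3 * ε * (- + 3) ^ suc j * falling b (+ 6) (suc (suc j ℕ.* 2)) ∎
    where
    open ≡-Reasoning
    a = + 6 * + suc j + + 3
    b = + 6 * + suc j + ε
    w = + 6 * + suc j
    t = (- + 3) ^ j
    G = falling (+ 6 * + j + + 3) (+ 2) (j ℕ.* 2)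
    Q = falling (+ 6 * + j + ε) (+ 6) (suc (j ℕ.* 2))
    a-6 : ∀ j → + 6 * (+ 1 + j) + + 3 - + 2 - + 2 - + 2 ≡ + 6 * j + + 3
    a-6 = solve-∀
    b-6 : ∀ ε j → + 6 * (+ 1 + j) + ε - + 6 ≡ + 6 * j + ε
    b-6 = solve-∀
    left : ∀ j G → let a = + 6 * (+ 1 + j) + + 3 ; w = + 6 * (+ 1 + j) in
      a * ((a - + 2) * ((a - + 2 - + 2) * G)) ≡ + 3 * (w * w - 1ℤ) * (G * (+ 6 * j + + 3 - + 2 * (j * + 2)))
    left = solve-∀
    right : ∀ ε j t Q → let b = + 6 * (+ 1 + j) + ε ; w = + 6 * (+ 1 + j) in
      + 3 * (w * w - ε * ε) * (+ 3 * ε * t * Q) ≡ + 3 * ε * (- + 3 * t) * (b * Q * (b - + 6 * (+ 2 + j * + 2)))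
    right = solve-∀

  -- Arithmetic modulo a prime p.

  module Modℤ (p : ℕ) (p-prime : Prime p) where
    open Quotient +-*-commutativeRing (+ p) public
    private
      instance
        _ = prime⇒nonZero p-prime

    p∣⇒Multiple : ∀ {z} → p ℕ∣ ∣ z ∣ → Multiple z
    p∣⇒Multiple {z} p∣z with divides q z≡qp ← ∣ᵤ⇒∣ {+ p} {z} p∣z = q , trans z≡qp (*-comm q (+ p))

    Multiple⇒p∣ : ∀ {z} → Multiple z → p ℕ∣ ∣ z ∣
    Multiple⇒p∣ {z} (q , z≡pq) = ∣⇒∣ᵤ (divides q (trans z≡pq (*-comm (+ p) q)))

    Multiple-prime : ∀ x y → Multiple (x * y) → Multiple x ⊎ Multiple y
    Multiple-prime x y m = Sum.map p∣⇒Multiple p∣⇒Multiple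
      (euclidsLemma ∣ x ∣ ∣ y ∣ p-prime (subst (p ℕ∣_) (abs-* x y) (Multiple⇒p∣ m)))

    -- Encoded as non-divisibility, the form in which the hypotheses supply it; `inverse` and
    -- `Unit-invertible` link it to invertibility modulo p.
    Unit : ℤ → Set
    Unit z = ¬ Multiple z

    Unit-* : ∀ {x y} → Unit x → Unit y → Unit (x * y)
    Unit-* {x} {y} ux uy = [ ux , uy ]′ ∘ Multiple-prime x y

    Unit-1 : Unit 1ℤ
    Unit-1 m = >⇒∤ (nonTrivial⇒n>1 p {{prime⇒nonTrivial p-prime}}) (Multiple⇒p∣ m)

    Unit-^ : ∀ {x} n → Unit x → Unit (x ^ n)
    Unit-^ zero    ux = Unit-1
    Unit-^ (suc n) ux = Unit-* ux (Unit-^ n ux)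

    Unit-! : ∀ {n} → n ℕ.< p → Unit (+ (n !))
    Unit-! n<p m = ∤-! p-prime n<p (Multiple⇒p∣ m)

    Multiple-≋ : ∀ {x y} → x ≋ y → Multiple y → Multiple x
    Multiple-≋ {x} {y} (from-multiple d) my = Multiple-resp (split x y) (Multiple-+ d my)
      where
      split : ∀ x y → x ≡ (x - y) + y
      split = solve-∀

    Unit-invertible : ∀ z t → z * t ≋ 1ℤ → Unit z
    Unit-invertible z t zt≋1 mz = Unit-1 (Multiple-≋ (≋-sym zt≋1) (Multiple-*ʳ t mz))

    *-cancelˡ : ∀ {u} → Unit u → ∀ {x y} → u * x ≋ u * y → x ≋ y
    *-cancelˡ {u} uu {x} {y} (from-multiple m) = from-multiple ([ (λ mu → contradiction mu uu) , id ]′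
      (Multiple-prime u (x - y) (Multiple-resp (distrib u x y) m)))
      where
      distrib : ∀ u x y → u * (x - y) ≡ u * x - u * y
      distrib = solve-∀

    ≋-^-cong : ∀ {x y} n → x ≋ y → x ^ n ≋ y ^ n
    ≋-^-cong zero    x≋y = ≋-reflexive refl
    ≋-^-cong (suc n) x≋y = ≋-*-cong x≋y (≋-^-cong n x≋y)

    ≋-falling-cong : ∀ {a b} s n → a ≋ b → falling a s n ≋ falling b s n
    ≋-falling-cong s zero    a≋b = ≋-reflexive refl
    ≋-falling-cong s (suc n) a≋b =
      ≋-*-cong a≋b (≋-falling-cong s n (≋-+-cong a≋b (≋-refl { - s})))

    +p≋ : ∀ x → + p + x ≋ x
    +p≋ x = from-multiple (1ℤ , rearrange (+ p) x)
      where
      rearrange : ∀ p x → p + x - x ≡ p * 1ℤ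
      rearrange = solve-∀

    fermatℤ : ∀ z → z ^ p ≋ z
    -- `fermat` speaks only of sums of ones, so z is first replaced by its remainder, a natural
    -- number.
    fermatℤ z = ≋-trans (≋-^-cong p z≋r) (≋-trans (fermatℕ (z %ℕ p)) (≋-sym z≋r))
      where
      rearrange : ∀ r q p → r + q * p - r ≡ p * q
      rearrange = solve-∀
      z≋r : z ≋ + (z %ℕ p)
      z≋r = from-multiple (z /ℕ p ,
        trans (cong (_- + (z %ℕ p)) (a≡a%ℕn+[a/ℕn]*n z p)) (rearrange (+ (z %ℕ p)) (z /ℕ p) (+ p)))
      open Frobenius quotientRing using (fermat) renaming (_^_ to _^′_; _×_ to _×′_)
      ×1≡+ : ∀ n → n ×′ 1ℤ ≡ + n
      ×1≡+ zero    = refl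
      ×1≡+ (suc n) = cong (λ x → 1ℤ + x) (×1≡+ n)
      ^′≡^ : ∀ x n → x ^′ n ≡ x ^ n
      ^′≡^ x zero    = refl
      ^′≡^ x (suc n) = cong (x *_) (^′≡^ x n)
      p×1≋0 : p ×′ 1ℤ ≋ 0ℤ
      p×1≋0 = subst (_≋ 0ℤ) (trans (+-identityʳ (+ p)) (sym (×1≡+ p))) (+p≋ 0ℤ)
      fermatℕ : ∀ n → (+ n) ^ p ≋ + n
      fermatℕ n = subst₂ _≋_ (trans (cong (_^′ p) (×1≡+ n)) (^′≡^ (+ n) p)) (×1≡+ n) (fermat p-prime p×1≋0 n)

    -- The witness is z^(p - 2): cancel one factor z in z^p ≡ z.
    inverse : ∀ {z} → Unit z → ∃ λ t → z * t ≋ 1ℤ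
    inverse {z} uz = invert p (nonTrivial⇒n>1 p {{prime⇒nonTrivial p-prime}}) (fermatℤ z)
      where
      invert : ∀ n → 1 ℕ.< n → z ^ n ≋ z → ∃ λ t → z * t ≋ 1ℤ
      invert (suc zero)    (s≤s ())
      invert (suc (suc n)) _ zⁿ≋z = z ^ n , *-cancelˡ uz (≋-trans zⁿ≋z (≋-reflexive (sym (*-identityʳ z))))

  -- The congruence between C(3k, k) and C(h + j, 2j + 1).

  module BinomialCongruence (p : ℕ) (p-prime : Prime p) (p>3 : p > 3) (q h : ℕ) (ε : ℤ)
    (p≡1+2q : p ≡ suc (q ℕ.* 2)) (p≡6h-ε : + p ≡ + 6 * + h - ε) (ε²≡1 : ε * ε ≡ 1ℤ) (h≤q : h ℕ.≤ q) where
    open Modℤ p p-prime public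
    Unit-small : ∀ n → suc n ℕ.< p → Unit (+ suc n)
    Unit-small n n<p m = >⇒∤ n<p (Multiple⇒p∣ m)

    Unit-2 : Unit (+ 2)
    Unit-2 = Unit-small 1 (ℕ.<-trans (ℕ.n<1+n 2) p>3)

    Unit-3 : Unit (+ 3)
    Unit-3 = Unit-small 2 p>3

    module _ {j} (j<h : j ℕ.< h) where
      private
        -- Here k = (p + 1)/2 + j, and n is chosen so that 3k = p + n and 2n = p + 6j + 3 hold
        -- exactly.
        k = suc q ℕ.+ j
        m = suc (j ℕ.* 2)
        n = k ℕ.+ m

        j<q : j ℕ.< q
        j<q = ℕ.≤-trans j<h h≤q

        k<p : k ℕ.< p
        k<p = subst (k ℕ.<_) (trans (cong suc (double q)) (sym p≡1+2q)) (s≤s (ℕ.+-monoʳ-< q j<q))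
          where
          double : ∀ q → q ℕ.+ q ≡ q ℕ.* 2
          double = ℕ-Solver.solve-∀

        m<p : m ℕ.< p
        m<p = subst (m ℕ.<_) (sym p≡1+2q) (s≤s (ℕ.*-monoˡ-< 2 j<q))

        3k≡p+n : + (3 ℕ.* k) ≡ + p + + n
        3k≡p+n = trans (cong +_ (trans (identity q j) (cong (ℕ._+ n) (sym p≡1+2q)))) (pos-+ p n)
          where
          identity : ∀ q j → 3 ℕ.* (suc q ℕ.+ j) ≡ suc (q ℕ.* 2) ℕ.+ (suc q ℕ.+ j ℕ.+ suc (j ℕ.* 2))
          identity = ℕ-Solver.solve-∀

        2n≡p+6j+3 : + 2 * + n ≡ + p + (+ 6 * + j + + 3)
        2n≡p+6j+3 = begin
          + 2 * + n                          ≡⟨ pos-* 2 n ⟨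
          + (2 ℕ.* n)                        ≡⟨ cong +_ (identity q j) ⟩
          + (suc (q ℕ.* 2) ℕ.+ (6 ℕ.* j ℕ.+ 3))  ≡⟨ cong (λ x → + (x ℕ.+ (6 ℕ.* j ℕ.+ 3))) p≡1+2q ⟨
          + (p ℕ.+ (6 ℕ.* j ℕ.+ 3))          ≡⟨ pos-+ p _ ⟩
          + p + + (6 ℕ.* j ℕ.+ 3)            ≡⟨ cong (λ x → + p + x) (pos-+ (6 ℕ.* j) 3) ⟩
          + p + (+ (6 ℕ.* j) + + 3)          ≡⟨ cong (λ x → + p + (x + + 3)) (pos-* 6 j) ⟩
          + p + (+ 6 * + j + + 3)            ∎
          where
          open ≡-Reasoning
          identity : ∀ q j → 2 ℕ.* (suc q ℕ.+ j ℕ.+ suc (j ℕ.* 2)) ≡ suc (q ℕ.* 2) ℕ.+ (6 ℕ.* j ℕ.+ 3)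
          identity = ℕ-Solver.solve-∀

        6[h+j]≡p+6j+ε : + 6 * + (h ℕ.+ j) ≡ + p + (+ 6 * + j + ε)
        6[h+j]≡p+6j+ε = begin
          + 6 * + (h ℕ.+ j)                        ≡⟨ cong (+ 6 *_) (pos-+ h j) ⟩
          + 6 * (+ h + + j)                        ≡⟨ identity (+ h) (+ j) ε ⟩
          + 6 * + h - ε + (+ 6 * + j + ε)          ≡⟨ cong (_+ (+ 6 * + j + ε)) p≡6h-ε ⟨
          + p + (+ 6 * + j + ε)                    ∎
          where
          open ≡-Reasoning
          identity : ∀ h j ε → + 6 * (h + j) ≡ + 6 * h - ε + (+ 6 * j + ε)
          identity = solve-∀

        -- After multiplication by k!, which is prime to p because k < p, both sides are falling
        -- factorials of k factors whose starting points differ by p.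
        C[3k,k]≋C[n,k] : + ((3 ℕ.* k) C k) ≋ + (n C k)
        C[3k,k]≋C[n,k] = *-cancelˡ (Unit-! k<p) (begin
          + (k !) * + ((3 ℕ.* k) C k)     ≡⟨ k!*nCk≡falling (3 ℕ.* k) k ⟩
          falling (+ (3 ℕ.* k)) 1ℤ k      ≡⟨ cong (λ x → falling x 1ℤ k) 3k≡p+n ⟩
          falling (+ p + + n) 1ℤ k        ≈⟨ ≋-falling-cong 1ℤ k (+p≋ (+ n)) ⟩
          falling (+ n) 1ℤ k              ≡⟨ k!*nCk≡falling n k ⟨
          + (k !) * + (n C k)             ∎)
          where open ≋-Reasoning

        -- Symmetry trades the lower entry k for m = 2j + 1, so that the product has as many factors
        -- as the one for C(h + j, 2j + 1).
        C[n,k]≡C[n,m] : n C k ≡ n C m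
        C[n,k]≡C[n,m] = trans (nCk≡nC[n∸k] (ℕ.m≤m+n k m)) (cong (n C_) (ℕ.m+n∸m≡n k m))

        -- Modulo p the upper entry N is the fraction b/u. The factor u^m clears it and stretches
        -- the step from 1 to u. The name a for u · 1 lets callers see the step as a literal.
        scaled : ∀ u a b N → u * + N ≡ + p + b → u * 1ℤ ≡ a → u ^ m * (+ (m !) * + (N C m)) ≋ falling b a m
        scaled u a b N uN≡p+b refl = begin
          u ^ m * (+ (m !) * + (N C m))       ≡⟨ cong (u ^ m *_) (k!*nCk≡falling N m) ⟩
          u ^ m * falling (+ N) 1ℤ m          ≡⟨ falling-scale u (+ N) 1ℤ m ⟩
          falling (u * + N) (u * 1ℤ) m        ≡⟨ cong (λ x → falling x (u * 1ℤ) m) uN≡p+b ⟩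
          falling (+ p + b) (u * 1ℤ) m        ≈⟨ ≋-falling-cong (u * 1ℤ) m (+p≋ b) ⟩
          falling b (u * 1ℤ) m                ∎
          where open ≋-Reasoning

      C[3k,k]≋ : + ((3 ℕ.* (suc q ℕ.+ j)) C (suc q ℕ.+ j))
               ≋ ε * + 9 * (- + 27) ^ j * + ((h ℕ.+ j) C suc (j ℕ.* 2))
      C[3k,k]≋ = *-cancelˡ (Unit-* (Unit-^ m Unit-2) (Unit-! m<p)) (begin
        (+ 2) ^ m * + (m !) * + ((3 ℕ.* k) C k)
          ≈⟨ ≋-*-cong (≋-refl {(+ 2) ^ m * + (m !)}) C[3k,k]≋C[n,k] ⟩
        (+ 2) ^ m * + (m !) * + (n C k)
          ≡⟨ cong (λ x → (+ 2) ^ m * + (m !) * + x) C[n,k]≡C[n,m] ⟩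
        (+ 2) ^ m * + (m !) * + (n C m)
          ≡⟨ assoc ((+ 2) ^ m) (+ (m !)) _ ⟩
        (+ 2) ^ m * (+ (m !) * + (n C m))
          ≈⟨ scaled (+ 2) (+ 2) (+ 6 * + j + + 3) n 2n≡p+6j+3 refl ⟩
        falling (+ 6 * + j + + 3) (+ 2) m
          ≡⟨ falling-2-6 {ε} ε²≡1 j ⟩
        + 3 * ε * (- + 3) ^ j * falling (+ 6 * + j + ε) (+ 6) m
          ≈⟨ ≋-*-cong (≋-refl {+ 3 * ε * (- + 3) ^ j}) (scaled (+ 6) (+ 6) (+ 6 * + j + ε) (h ℕ.+ j) 6[h+j]≡p+6j+ε refl) ⟨
        + 3 * ε * (- + 3) ^ j * ((+ 6) ^ m * (+ (m !) * Y))
          -- Since m = 2j + 1, 6^m = 2^m · 3 · 9^j. With 3ε(-3)^j from `falling-2-6` this produces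
          -- the constant 9ε(-27)^j.
          ≡⟨ cong (λ x → + 3 * ε * (- + 3) ^ j * (x * (+ (m !) * Y))) 6^m ⟩
        + 3 * ε * (- + 3) ^ j * ((+ 2) ^ m * (+ 3 * (+ 9) ^ j) * (+ (m !) * Y))
          ≡⟨ rearrange ε ((- + 3) ^ j) ((+ 9) ^ j) ((+ 2) ^ m) (+ (m !)) Y ⟩
        (+ 2) ^ m * + (m !) * (ε * + 9 * ((- + 3) ^ j * (+ 9) ^ j) * Y)
          ≡⟨ cong (λ x → (+ 2) ^ m * + (m !) * (ε * + 9 * x * Y)) (^-distribʳ-* (- + 3) (+ 9) j) ⟨
        (+ 2) ^ m * + (m !) * (ε * + 9 * (- + 27) ^ j * Y) ∎)
        where
        open ≋-Reasoning
        Y = + ((h ℕ.+ j) C m)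
        assoc : ∀ x y z → x * y * z ≡ x * (y * z)
        assoc = solve-∀
        rearrange : ∀ ε s t u v Y → + 3 * ε * s * (u * (+ 3 * t) * (v * Y)) ≡ u * v * (ε * + 9 * (s * t) * Y)
        rearrange = solve-∀
        6^m : (+ 6) ^ m ≡ (+ 2) ^ m * (+ 3 * (+ 9) ^ j)
        6^m = trans (^-distribʳ-* (+ 2) (+ 3) m)
          (cong (λ x → (+ 2) ^ m * (+ 3 * x)) (trans (cong ((+ 3) ^_) (ℕ.*-comm j 2)) (sym (^-*-assoc (+ 3) 2 j))))

  ∑ : ℕ → (ℕ → ℤ) → ℤ
  ∑ zero    f = 0ℤ
  ∑ (suc n) f = f 0 + ∑ n (f ∘ suc)

  -- Reduction of p-integral rationals modulo p.

  module Reduction (p : ℕ) (p-prime : Prime p) where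
    open Modℤ p p-prime
    open ≋-Reasoning

    -- Allowing any fraction that represents q avoids gcds in the closure properties.
    record Reduces (q : ℚ) (z : ℤ) : Set where
      constructor reduces
      field
        num      : ℤ
        den-1    : ℕ
        q≃       : toℚᵘ q ≃ mkℚᵘ num den-1
        den-unit : Unit (+ suc den-1)
        num≋     : num ≋ z * + suc den-1

    Reduces-≋ : ∀ {q z w} → z ≋ w → Reduces q z → Reduces q w
    Reduces-≋ z≋w (reduces u d q≃ ud u≋) = reduces u d q≃ ud (≋-trans u≋ (≋-*-cong z≋w (≋-refl {+ suc d})))

    Reduces-/1 : ∀ n → Reduces (n ℚ./ 1) n
    Reduces-/1 n = reduces n 0 (toℚᵘ-fromℚᵘ (mkℚᵘ n 0)) Unit-1 (≋-reflexive (sym (*-identityʳ n)))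

    private
      den-* : ∀ d e → Unit (+ suc d) → Unit (+ suc e) → Unit (+ (suc d ℕ.* suc e))
      den-* d e ud ue = subst Unit (sym (pos-* (suc d) (suc e))) (Unit-* ud ue)

    Reduces-+ : ∀ {q r z w} → Reduces q z → Reduces r w → Reduces (q ℚ.+ r) (z + w)
    Reduces-+ {q} {r} {z} {w} (reduces u d q≃ ud u≋) (reduces v e r≃ ue v≋) =
      reduces _ _ (ℚᵘ.≃-trans (toℚᵘ-homo-+ q r) (ℚᵘ.+-cong q≃ r≃)) (den-* d e ud ue) (begin
        u * E + v * D                ≈⟨ ≋-+-cong (≋-*-cong u≋ (≋-refl {E})) (≋-*-cong v≋ (≋-refl {D})) ⟩
        z * D * E + w * E * D        ≡⟨ rearrange z w D E ⟩
        (z + w) * (D * E)            ≡⟨ cong ((z + w) *_) (pos-* (suc d) (suc e)) ⟨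
        (z + w) * + (suc d ℕ.* suc e) ∎)
      where
      D = + suc d
      E = + suc e
      rearrange : ∀ z w D E → z * D * E + w * E * D ≡ (z + w) * (D * E)
      rearrange = solve-∀

    Reduces-* : ∀ {q r z w} → Reduces q z → Reduces r w → Reduces (q ℚ.* r) (z * w)
    Reduces-* {q} {r} {z} {w} (reduces u d q≃ ud u≋) (reduces v e r≃ ue v≋) =
      reduces _ _ (ℚᵘ.≃-trans (toℚᵘ-homo-* q r) (ℚᵘ.*-cong q≃ r≃)) (den-* d e ud ue) (begin
        u * v                        ≈⟨ ≋-*-cong u≋ v≋ ⟩
        z * D * (w * E)              ≡⟨ rearrange z w D E ⟩
        z * w * (D * E)              ≡⟨ cong (z * w *_) (pos-* (suc d) (suc e)) ⟨
        z * w * + (suc d ℕ.* suc e)  ∎)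
      where
      D = + suc d
      E = + suc e
      rearrange : ∀ z w D E → z * D * (w * E) ≡ z * w * (D * E)
      rearrange = solve-∀

    Reduces-neg : ∀ {q z} → Reduces q z → Reduces (ℚ.- q) (- z)
    Reduces-neg {q} {z} (reduces u d q≃ ud u≋) =
      reduces _ _ (ℚᵘ.≃-trans (toℚᵘ-homo‿- q) (ℚᵘ.-‿cong q≃)) ud
        (≋-trans (≋-neg-cong u≋) (≋-reflexive (rearrange z (+ suc d))))
      where
      rearrange : ∀ z d → - (z * d) ≡ - z * d
      rearrange = solve-∀

    Reduces-^ : ∀ {q z} → Reduces q z → ∀ n → Reduces (q ^ℚ n) (z ^ n)
    Reduces-^ r zero    = Reduces-/1 1ℤ
    Reduces-^ r (suc n) = Reduces-* r (Reduces-^ r n)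

    -- Comparing the chosen fraction u/d with the one in lowest terms gives `↥ q` · d = u · `↧ q`,
    -- where p divides u but not d.
    Reduces⇒∣ : ∀ {q z} → Reduces q z → Multiple z → + p ∣ℤ ↥ q
    Reduces⇒∣ {q} {z} (reduces u d (*≡* cross) ud u≋) mz =
      Multiple⇒p∣ ([ id , (λ md → contradiction md ud) ]′ (Multiple-prime (↥ q) (+ suc d)
        (Multiple-resp (cross′ q cross) (Multiple-*ʳ (↧ q) mu))))
      where
      cross′ : ∀ q → ℚᵘ.↥ toℚᵘ q * + suc d ≡ u * ℚᵘ.↧ toℚᵘ q → ↥ q * + suc d ≡ u * ↧ q
      cross′ (mkℚ _ _ _) eq = eq
      mu : Multiple u
      mu = Multiple-≋ u≋ (Multiple-*ʳ (+ suc d) mz)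

    private
      toℚᵘ-1/ : ∀ q u d .{{_ : ℚ.NonZero q}} .{{_ : ℚᵘ.NonZero (mkℚᵘ u d)}} →
        toℚᵘ q ≃ mkℚᵘ u d → toℚᵘ (ℚ.1/ q) ≃ ℚᵘ.1/ (mkℚᵘ u d)
      toℚᵘ-1/ (mkℚ +[1+ a ] b _) +[1+ n ] d (*≡* eq) =
        *≡* (trans (*-comm +[1+ b ] +[1+ n ]) (trans (sym eq) (*-comm +[1+ a ] +[1+ d ])))
      toℚᵘ-1/ (mkℚ -[1+ a ] b _) +[1+ n ] d (*≡* ())
      toℚᵘ-1/ (mkℚ -[1+ a ] b _) -[1+ n ] d (*≡* eq) =
        *≡* (trans (flip +[1+ b ] +[1+ n ]) (trans (sym eq) (flip +[1+ a ] +[1+ d ])))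
        where
        flip : ∀ x y → - x * y ≡ - y * x
        flip = solve-∀

    Reduces-inv : ∀ {q z t} → z * t ≋ 1ℤ → Reduces q z → Reduces (inv q) t
    Reduces-inv {q} {z} {t} zt≋1 (reduces u d q≃ ud u≋) with q ≟ 0ℚ
    -- The convention 0⁻¹ = 0 is excluded here: z t ≡ 1 makes the numerator u a unit modulo p, while
    -- q = 0 makes it zero.
    ... | yes refl = contradiction (0≃⇒Multiple q≃) unit-u
      where
      unit-u : Unit u
      unit-u mu = Unit-* (Unit-invertible z t zt≋1) ud (Multiple-≋ (≋-sym u≋) mu)
      0≃⇒Multiple : toℚᵘ 0ℚ ≃ mkℚᵘ u d → Multiple u
      0≃⇒Multiple (*≡* eq) = 0ℤ , trans (sym (*-identityʳ u)) (trans (sym eq) (sym (*-zeroʳ (+ p))))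
    ... | no q≢0 = go u q≃ u≋
      where
      instance
        _ = ℚ.≢-nonZero q≢0
      zt-cancel : ∀ w → z * w * t ≋ w
      zt-cancel w = begin
        z * w * t   ≡⟨ swap z w t ⟩
        z * t * w   ≈⟨ ≋-*-cong zt≋1 (≋-refl {w}) ⟩
        1ℤ * w      ≡⟨ *-identityˡ w ⟩
        w           ∎
        where
        swap : ∀ z w t → z * w * t ≡ z * t * w
        swap = solve-∀
      unit-u : ∀ {u} → u ≋ z * + suc d → Unit u
      unit-u u≋ mu = Unit-* (Unit-invertible z t zt≋1) ud (Multiple-≋ (≋-sym u≋) mu)
      go : ∀ u → toℚᵘ q ≃ mkℚᵘ u d → u ≋ z * + suc d → Reduces (ℚ.1/ q) t
      go (+ 0) q≃ u≋ = contradiction (0ℤ , sym (*-zeroʳ (+ p))) (unit-u u≋)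
      go +[1+ n ] q≃ u≋ = reduces _ _ (toℚᵘ-1/ q +[1+ n ] d q≃) (unit-u u≋) (begin
        +[1+ d ]               ≈⟨ zt-cancel +[1+ d ] ⟨
        z * +[1+ d ] * t       ≈⟨ ≋-*-cong u≋ (≋-refl {t}) ⟨
        +[1+ n ] * t           ≡⟨ *-comm +[1+ n ] t ⟩
        t * +[1+ n ]           ∎)
      -- Denominators are positive, so inverting a negative fraction moves the sign to the new
      -- numerator and both sides of the congruence are negated.
      go -[1+ n ] q≃ u≋ = reduces _ _ (toℚᵘ-1/ q -[1+ n ] d q≃)
        (λ m → unit-u u≋ (Multiple-neg m)) (begin
        - +[1+ d ]             ≈⟨ ≋-neg-cong (zt-cancel +[1+ d ]) ⟨
        - (z * +[1+ d ] * t)   ≈⟨ ≋-neg-cong (≋-*-cong u≋ (≋-refl {t})) ⟨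
        - (- +[1+ n ] * t)     ≡⟨ rearrange +[1+ n ] t ⟩
        t * +[1+ n ]           ∎)
        where
        rearrange : ∀ n t → - (- n * t) ≡ t * n
        rearrange = solve-∀

    Reduces-sumFromTo : ∀ lo hi (f : ℕ → ℚ) (F : ℕ → ℤ) → (∀ k → Reduces (f k) (F k)) →
      Reduces (sumFromTo lo hi f) (∑ (suc hi ℕ.∸ lo) (λ i → F (lo ℕ.+ i)))
    Reduces-sumFromTo lo hi f F red = go (suc hi ℕ.∸ lo) id
      where
      -- `upTo` is `applyUpTo id`, and its tail re-indexes by `suc`; generalising `id` to φ makes
      -- the induction go through.
      go : ∀ n φ → Reduces (foldr ℚ._+_ 0ℚ (map (λ i → f (lo ℕ.+ i)) (applyUpTo φ n)))
                           (∑ n (λ i → F (lo ℕ.+ φ i)))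
      go zero    φ = Reduces-/1 0ℤ
      go (suc n) φ = Reduces-+ (red (lo ℕ.+ φ 0)) (go n (φ ∘ suc))

    InD⇒Unit-↧ : ∀ {c} → InD p c → Unit (↧ c)
    InD⇒Unit-↧ p∤↧c m = p∤↧c (Multiple⇒p∣ m)

    Reduces-self : ∀ c {t} → InD p c → ↧ c * t ≋ 1ℤ → Reduces c (↥ c * t)
    Reduces-self c@(mkℚ u d _) {t} inD dt≋1 =
      reduces u d ℚᵘ.≃-refl (InD⇒Unit-↧ {c} inD) (begin
        u                    ≡⟨ *-identityʳ u ⟨
        u * 1ℤ               ≈⟨ ≋-*-cong (≋-refl {u}) dt≋1 ⟨
        u * (+ suc d * t)    ≡⟨ rearrange u (+ suc d) t ⟩
        u * t * + suc d      ∎)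
      where
      rearrange : ∀ u d t → u * (d * t) ≡ u * t * d
      rearrange = solve-∀

  -- Finite sums of integers.

  ∑-cong : ∀ n {f g} → (∀ i → f i ≡ g i) → ∑ n f ≡ ∑ n g
  ∑-cong zero    f≡g = refl
  ∑-cong (suc n) f≡g = cong₂ _+_ (f≡g 0) (∑-cong n (f≡g ∘ suc))

  ∑-distrib-+ : ∀ n f g → ∑ n (λ i → f i + g i) ≡ ∑ n f + ∑ n g
  ∑-distrib-+ zero    f g = refl
  ∑-distrib-+ (suc n) f g =
    trans (cong (λ x → f 0 + g 0 + x) (∑-distrib-+ n (f ∘ suc) (g ∘ suc)))
          (interchange (f 0) (g 0) (∑ n (f ∘ suc)) (∑ n (g ∘ suc)))
    where
    interchange : ∀ a b c d → a + b + (c + d) ≡ (a + c) + (b + d)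
    interchange = solve-∀

  ∑-distribˡ-* : ∀ a n f → ∑ n (λ i → a * f i) ≡ a * ∑ n f
  ∑-distribˡ-* a zero    f = sym (*-zeroʳ a)
  ∑-distribˡ-* a (suc n) f =
    trans (cong (λ x → a * f 0 + x) (∑-distribˡ-* a n (f ∘ suc))) (distrib a (f 0) (∑ n (f ∘ suc)))
    where
    distrib : ∀ a b c → a * b + a * c ≡ a * (b + c)
    distrib = solve-∀

  ∑-last : ∀ n f → ∑ (suc n) f ≡ ∑ n f + f n
  ∑-last zero    f = comm (f 0)
    where
    comm : ∀ x → x + 0ℤ ≡ 0ℤ + x
    comm = solve-∀
  ∑-last (suc n) f = trans (cong (λ x → f 0 + x) (∑-last n (f ∘ suc))) (assoc (f 0) (∑ n (f ∘ suc)) (f (suc n)))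
    where
    assoc : ∀ a b c → a + (b + c) ≡ a + b + c
    assoc = solve-∀

  -- Recurrences for the two families of binomial sums.

  module BinomialSums (y : ℤ) where

    oddTerm evenTerm : ℕ → ℕ → ℤ
    oddTerm  h j = + ((h ℕ.+ j) C suc (j ℕ.* 2)) * y ^ j
    evenTerm h j = + ((h ℕ.+ j) C (j ℕ.* 2)) * y ^ j

    -- These are the Morgan-Voyce polynomials at y: `oddSum h` is B_(h-1)(y) and `evenSum h` is
    -- b_h(y). The even family is introduced because Pascal's rule couples the two.
    oddSum evenSum : ℕ → ℤ
    oddSum  h = ∑ h (oddTerm h)
    evenSum h = ∑ (suc h) (evenTerm h)

    private
      pascal : ∀ n k → + (suc n C suc k) ≡ + (n C k) + + (n C suc k)
      pascal n k = trans (cong +_ (sym (nCk+nC[k+1]≡[n+1]C[k+1] n k))) (pos-+ (n C k) (n C suc k))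

      distribʳ : ∀ a b c → (a + b) * c ≡ a * c + b * c
      distribʳ = solve-∀

      vanish : ∀ {n k} t x → n ℕ.< k → x + + (n C k) * t ≡ x
      vanish t x n<k = trans (cong (λ c → x + + c * t) (k>n⇒nCk≡0 n<k)) (+-identityʳ x)

      h+h≡h*2 : ∀ h → h ℕ.+ h ≡ h ℕ.* 2
      h+h≡h*2 = ℕ-Solver.solve-∀

    -- Pascal's rule splits each term; the surplus odd term at j = h contains C(2h, 2h + 1) = 0.
    oddSum-suc : ∀ h → oddSum (suc h) ≡ evenSum h + oddSum h
    oddSum-suc h = begin
      ∑ (suc h) (oddTerm (suc h))
        ≡⟨ ∑-cong (suc h) (λ j → trans (cong (_* y ^ j) (pascal (h ℕ.+ j) (j ℕ.* 2)))
             (distribʳ (+ ((h ℕ.+ j) C (j ℕ.* 2))) (+ ((h ℕ.+ j) C suc (j ℕ.* 2))) (y ^ j))) ⟩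
      ∑ (suc h) (λ j → evenTerm h j + oddTerm h j)
        ≡⟨ ∑-distrib-+ (suc h) (evenTerm h) (oddTerm h) ⟩
      evenSum h + ∑ (suc h) (oddTerm h)
        ≡⟨ cong (λ x → evenSum h + x) (trans (∑-last h (oddTerm h))
             (vanish (y ^ h) (oddSum h) (s≤s (ℕ.≤-reflexive (h+h≡h*2 h))))) ⟩
      evenSum h + oddSum h ∎
      where open ≡-Reasoning

    -- Pascal's rule again, applied to the terms with j > 0, where one power of y comes out; the
    -- surplus even term contains C(2h + 1, 2h + 2) = 0.
    evenSum-suc : ∀ h → evenSum (suc h) ≡ evenSum h + y * oddSum (suc h)
    evenSum-suc h = begin
      -- The terms `evenTerm (suc h) 0` and `evenTerm h 0` agree by computation, since both
      -- binomials have lower entry 0.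
      evenTerm h 0 + ∑ (suc h) (λ i → evenTerm (suc h) (suc i))
        ≡⟨ cong (λ x → evenTerm h 0 + x) (∑-cong (suc h) step) ⟩
      evenTerm h 0 + ∑ (suc h) (λ i → evenTerm h (suc i) + y * oddTerm (suc h) i)
        ≡⟨ cong (λ x → evenTerm h 0 + x) (∑-distrib-+ (suc h) (evenTerm h ∘ suc) (λ i → y * oddTerm (suc h) i)) ⟩
      evenTerm h 0 + (∑ (suc h) (evenTerm h ∘ suc) + ∑ (suc h) (λ i → y * oddTerm (suc h) i))
        ≡⟨ cong (λ x → evenTerm h 0 + (∑ (suc h) (evenTerm h ∘ suc) + x)) (∑-distribˡ-* y (suc h) (oddTerm (suc h))) ⟩
      evenTerm h 0 + (∑ (suc h) (evenTerm h ∘ suc) + y * oddSum (suc h))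
        ≡⟨ assoc (evenTerm h 0) (∑ (suc h) (evenTerm h ∘ suc)) (y * oddSum (suc h)) ⟩
      ∑ (suc (suc h)) (evenTerm h) + y * oddSum (suc h)
        ≡⟨ cong (_+ y * oddSum (suc h)) (trans (∑-last (suc h) (evenTerm h))
             (vanish (y ^ suc h) (evenSum h) (s≤s (ℕ.≤-reflexive (trans (ℕ.+-suc h h) (cong suc (h+h≡h*2 h))))))) ⟩
      evenSum h + y * oddSum (suc h) ∎
      where
      open ≡-Reasoning
      assoc : ∀ a b c → a + (b + c) ≡ a + b + c
      assoc = solve-∀
      rearrange : ∀ a b y t → (a + b) * (y * t) ≡ b * (y * t) + y * (a * t)
      rearrange = solve-∀
      step : ∀ i → evenTerm (suc h) (suc i) ≡ evenTerm h (suc i) + y * oddTerm (suc h) i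
      step i = begin
        + (suc (h ℕ.+ suc i) C suc (suc (i ℕ.* 2))) * (y * y ^ i)
          ≡⟨ cong (_* (y * y ^ i)) (pascal (h ℕ.+ suc i) (suc (i ℕ.* 2))) ⟩
        (+ ((h ℕ.+ suc i) C suc (i ℕ.* 2)) + + ((h ℕ.+ suc i) C suc (suc (i ℕ.* 2)))) * (y * y ^ i)
          ≡⟨ rearrange (+ ((h ℕ.+ suc i) C suc (i ℕ.* 2))) (+ ((h ℕ.+ suc i) C suc (suc (i ℕ.* 2)))) y (y ^ i) ⟩
        evenTerm h (suc i) + y * (+ ((h ℕ.+ suc i) C suc (i ℕ.* 2)) * y ^ i)
          ≡⟨ cong (λ n → evenTerm h (suc i) + y * (+ (n C suc (i ℕ.* 2)) * y ^ i)) (ℕ.+-suc h i) ⟩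
        evenTerm h (suc i) + y * oddTerm (suc h) i ∎

  embed-* : ∀ a b → embed (a * b) ≡ embed a *ω embed b
  embed-* a b = cong₂ eisenstein (real a b) (imaginary a b)
    where
    real : ∀ a b → a * b ≡ a * b - 0ℤ * 0ℤ
    real = solve-∀
    imaginary : ∀ a b → 0ℤ ≡ a * 0ℤ + 0ℤ * b - 0ℤ * 0ℤ
    imaginary = solve-∀

  embed-^ : ∀ a n → embed (a ^ n) ≡ embed a ^ω n
  embed-^ a zero    = refl
  embed-^ a (suc n) = trans (embed-* a (a ^ n)) (cong (embed a *ω_) (embed-^ a n))

  -- With y = (α - β)² / (αβ), oddSum (h + 1) and evenSum h are, up to the factor (αβ)^h,
  -- (α^(2h+2) - β^(2h+2)) / (α² - β²) and (α^(2h+1) + β^(2h+1)) / (α + β).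
  module ClosedForms (π α β : ℤω) (y : ℤ) where
    open Quotient ℤω-commutativeRing π
    open BinomialSums y

    module _ (αβy≋[α-β]² : α *ω β *ω embed y ≋ (α -ω β) *ω (α -ω β)) where

      private
        Y = embed y
        F G : ℕ → ℤω
        F h = embed (oddSum h)
        G h = embed (evenSum h)

      evenSum-closed : ∀ h → (α *ω β) ^ω h *ω (α +ω β) *ω G h ≋ α ^ω suc (h ℕ.* 2) +ω β ^ω suc (h ℕ.* 2)
      oddSum-closed : ∀ h → (α *ω β) ^ω h *ω (α *ω α -ω β *ω β) *ω F (suc h) ≋ α ^ω (suc h ℕ.* 2) -ω β ^ω (suc h ℕ.* 2)

      evenSum-closed zero    = ≋-reflexive (base α β)
        where
        base : ∀ α β → 1ω *ω (α +ω β) *ω 1ω ≡ α *ω 1ω +ω β *ω 1ω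
        base = solveω-∀ ωring
      evenSum-closed (suc h) = begin
        α *ω β *ω n *ω (α +ω β) *ω G (suc h)
          ≡⟨ cong (λ x → α *ω β *ω n *ω (α +ω β) *ω x) (trans (cong embed (evenSum-suc h)) (cong (G h +ω_) (embed-* y (oddSum (suc h))))) ⟩
        α *ω β *ω n *ω (α +ω β) *ω (G h +ω Y *ω F (suc h))
          ≡⟨ split α β n (G h) Y (F (suc h)) ⟩
        α *ω β *ω (n *ω (α +ω β) *ω G h) +ω (α *ω β *ω Y) *ω (n *ω (α +ω β) *ω F (suc h))
          -- Replacing αβ y by (α - β)² supplies the factor α - β that turns α + β into α² - β², the
          -- form that `oddSum-closed` at h requires.
          ≈⟨ ≋-+-cong (≋-*-cong (≋-refl {α *ω β}) (evenSum-closed h)) (≋-*-cong αβy≋[α-β]² (≋-refl {n *ω (α +ω β) *ω F (suc h)})) ⟩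
        α *ω β *ω (α *ω a +ω β *ω b) +ω (α -ω β) *ω (α -ω β) *ω (n *ω (α +ω β) *ω F (suc h))
          ≡⟨ cong (α *ω β *ω (α *ω a +ω β *ω b) +ω_) (regroup α β n (F (suc h))) ⟩
        α *ω β *ω (α *ω a +ω β *ω b) +ω (α -ω β) *ω (n *ω (α *ω α -ω β *ω β) *ω F (suc h))
          ≈⟨ ≋-+-cong (≋-refl {α *ω β *ω (α *ω a +ω β *ω b)}) (≋-*-cong (≋-refl {α -ω β}) (oddSum-closed h)) ⟩
        α *ω β *ω (α *ω a +ω β *ω b) +ω (α -ω β) *ω (α *ω (α *ω a) -ω β *ω (β *ω b))
          ≡⟨ collect α β a b ⟩
        α *ω (α *ω (α *ω a)) +ω β *ω (β *ω (β *ω b)) ∎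
        where
        open ≋-Reasoning
        n = (α *ω β) ^ω h
        a = α ^ω (h ℕ.* 2)
        b = β ^ω (h ℕ.* 2)
        split : ∀ α β n g y f → α *ω β *ω n *ω (α +ω β) *ω (g +ω y *ω f)
          ≡ α *ω β *ω (n *ω (α +ω β) *ω g) +ω (α *ω β *ω y) *ω (n *ω (α +ω β) *ω f)
        split = solveω-∀ ωring
        regroup : ∀ α β n f → (α -ω β) *ω (α -ω β) *ω (n *ω (α +ω β) *ω f) ≡ (α -ω β) *ω (n *ω (α *ω α -ω β *ω β) *ω f)
        regroup = solveω-∀ ωring
        collect : ∀ α β a b → α *ω β *ω (α *ω a +ω β *ω b) +ω (α -ω β) *ω (α *ω (α *ω a) -ω β *ω (β *ω b))
          ≡ α *ω (α *ω (α *ω a)) +ω β *ω (β *ω (β *ω b))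
        collect = solveω-∀ ωring

      oddSum-closed zero    = ≋-reflexive (base α β)
        where
        base : ∀ α β → 1ω *ω (α *ω α -ω β *ω β) *ω 1ω ≡ α *ω (α *ω 1ω) -ω β *ω (β *ω 1ω)
        base = solveω-∀ ωring
      oddSum-closed (suc h) = begin
        α *ω β *ω n *ω (α *ω α -ω β *ω β) *ω F (suc (suc h))
          ≡⟨ cong (λ x → α *ω β *ω n *ω (α *ω α -ω β *ω β) *ω embed x) (oddSum-suc (suc h)) ⟩
        α *ω β *ω n *ω (α *ω α -ω β *ω β) *ω (G (suc h) +ω F (suc h))
          -- Here α² - β² is factored as (α - β)(α + β) to fit the even closed form at h + 1, which
          -- itself rests only on the two closed forms at h.
          ≡⟨ split α β n (G (suc h)) (F (suc h)) ⟩
        (α -ω β) *ω (α *ω β *ω n *ω (α +ω β) *ω G (suc h)) +ω α *ω β *ω (n *ω (α *ω α -ω β *ω β) *ω F (suc h))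
          ≈⟨ ≋-+-cong (≋-*-cong (≋-refl {α -ω β}) (evenSum-closed (suc h))) (≋-*-cong (≋-refl {α *ω β}) (oddSum-closed h)) ⟩
        (α -ω β) *ω (α *ω (α *ω a) +ω β *ω (β *ω b)) +ω α *ω β *ω (α *ω a -ω β *ω b)
          ≡⟨ collect α β a b ⟩
        α *ω (α *ω (α *ω a)) -ω β *ω (β *ω (β *ω b)) ∎
        where
        open ≋-Reasoning
        n = (α *ω β) ^ω h
        a = α ^ω suc (h ℕ.* 2)
        b = β ^ω suc (h ℕ.* 2)
        split : ∀ α β n g f → α *ω β *ω n *ω (α *ω α -ω β *ω β) *ω (g +ω f)
          ≡ (α -ω β) *ω (α *ω β *ω n *ω (α +ω β) *ω g) +ω α *ω β *ω (n *ω (α *ω α -ω β *ω β) *ω f)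
        split = solveω-∀ ωring
        collect : ∀ α β a b → (α -ω β) *ω (α *ω (α *ω a) +ω β *ω (β *ω b)) +ω α *ω β *ω (α *ω a -ω β *ω b)
          ≡ α *ω (α *ω (α *ω a)) -ω β *ω (β *ω (β *ω b))
        collect = solveω-∀ ωring

  -- Powers and congruences in ℤ[ω].

  ^ω-+ : ∀ x m n → x ^ω (m ℕ.+ n) ≡ x ^ω m *ω x ^ω n
  ^ω-+ x zero    n = one (x ^ω n)
    where
    one : ∀ x → x ≡ 1ω *ω x
    one = solveω-∀ ωring
  ^ω-+ x (suc m) n = trans (cong (x *ω_) (^ω-+ x m n)) (assoc x (x ^ω m) (x ^ω n))
    where
    assoc : ∀ x y z → x *ω (y *ω z) ≡ x *ω y *ω z
    assoc = solveω-∀ ωring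

  ^ω-assoc : ∀ x m n → (x ^ω m) ^ω n ≡ x ^ω (n ℕ.* m)
  ^ω-assoc x m zero    = refl
  ^ω-assoc x m (suc n) = trans (cong (x ^ω m *ω_) (^ω-assoc x m n)) (sym (^ω-+ x m (n ℕ.* m)))

  ^ω-distrib-* : ∀ x y n → (x *ω y) ^ω n ≡ x ^ω n *ω y ^ω n
  ^ω-distrib-* x y zero    = refl
  ^ω-distrib-* x y (suc n) = trans (cong (x *ω y *ω_) (^ω-distrib-* x y n)) (interchange x y (x ^ω n) (y ^ω n))
    where
    interchange : ∀ x y u v → x *ω y *ω (u *ω v) ≡ x *ω u *ω (y *ω v)
    interchange = solveω-∀ ωring

  √-3 : ℤω
  √-3 = eisenstein (+ 1) (+ 2)

  module Modω (p : ℕ) (p-prime : Prime p) (π : ℤω) (π∣p : π ∣ω embed (+ p)) where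
    open Modℤ p p-prime
    open Quotient ℤω-commutativeRing π public using () renaming
      ( _≋_ to _≋ω_ ; from-multiple to from-multipleω ; to-multiple to to-multipleω ; quotientRing to quotientRingω
      ; Multiple-resp to Multipleω-resp ; Multiple-*ʳ to Multipleω-*ʳ
      ; ≋-refl to ≋ω-refl
      ; ≋-+-cong to ≋ω-+-cong ; ≋-neg-cong to ≋ω-neg-cong ; ≋-*-cong to ≋ω-*-cong ; module ≋-Reasoning to ≋ω-Reasoning )

    ≋ω-^-cong : ∀ {x z} n → x ≋ω z → x ^ω n ≋ω z ^ω n
    ≋ω-^-cong zero    x≋z = ≋ω-refl
    ≋ω-^-cong (suc n) x≋z = ≋ω-*-cong x≋z (≋ω-^-cong n x≋z)

    embed-≋ : ∀ {x z} → x ≋ z → embed x ≋ω embed z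
    embed-≋ (from-multiple (γ , x-z≡pγ)) =
      from-multipleω (Multipleω-resp (trans (cong embed x-z≡pγ) (embed-* (+ p) γ)) (Multipleω-*ʳ (embed γ) π∣p))

    -- An inverse of the rational integer u modulo p is also one modulo π, since π divides p. All
    -- cancellation in ℤ[ω] is of this kind.
    embed-cancelˡ : ∀ {u} → Unit u → ∀ {x z} → embed u *ω x ≋ω embed u *ω z → x ≋ω z
    embed-cancelˡ {u} unit-u {x} {z} ux≋uz with t , ut≋1 ← inverse unit-u = begin
      x                            ≈⟨ undo x ⟨
      embed t *ω (embed u *ω x)    ≈⟨ ≋ω-*-cong (≋ω-refl {embed t}) ux≋uz ⟩
      embed t *ω (embed u *ω z)    ≈⟨ undo z ⟩
      z                            ∎
      where
      open ≋ω-Reasoning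
      rearrange : ∀ t u x → t *ω (u *ω x) ≡ u *ω t *ω x
      rearrange = solveω-∀ ωring
      one : ∀ x → 1ω *ω x ≡ x
      one = solveω-∀ ωring
      undo : ∀ x → embed t *ω (embed u *ω x) ≋ω x
      undo x = begin
        embed t *ω (embed u *ω x)    ≡⟨ rearrange (embed t) (embed u) x ⟩
        embed u *ω embed t *ω x      ≡⟨ cong (_*ω x) (embed-* u t) ⟨
        embed (u * t) *ω x           ≈⟨ ≋ω-*-cong (embed-≋ ut≋1) (≋ω-refl {x}) ⟩
        1ω *ω x                      ≡⟨ one x ⟩
        x                            ∎

  -- The sum as a difference of powers of α and β.

  module MainSum (p : ℕ) (p-prime : Prime p) (p>3 : p > 3) (q h-1 : ℕ) (ε : ℤ)
    (p≡1+2q : p ≡ suc (q ℕ.* 2)) (p≡6h-ε : + p ≡ + 6 * + suc h-1 - ε) (ε²≡1 : ε * ε ≡ 1ℤ) (h≤q : suc h-1 ℕ.≤ q)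
    (a X : ℤ) where
    private
      h = suc h-1
      N = a * a + + 3
      -- X stands for 4/(9N) modulo p; the factor -27 is the one in `C[3k,k]≋`, and y becomes -12/N.
      y = - + 27 * X
    open BinomialCongruence p p-prime p>3 q h ε p≡1+2q p≡6h-ε ε²≡1 h≤q public
    open BinomialSums y

    halfSum : ℤ
    halfSum = ∑ h (λ i → + ((3 ℕ.* (suc q ℕ.+ i)) C (suc q ℕ.+ i)) * X ^ (suc q ℕ.+ i))

    ≋-∑-cong : ∀ n {f g} → (∀ {i} → i ℕ.< n → f i ≋ g i) → ∑ n f ≋ ∑ n g
    ≋-∑-cong zero    f≋g = ≋-refl
    ≋-∑-cong (suc n) f≋g = ≋-+-cong (f≋g (s≤s z≤n)) (≋-∑-cong n (f≋g ∘ s≤s))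

    halfSum≋ : halfSum ≋ ε * + 9 * X ^ suc q * oddSum h
    halfSum≋ = begin
      halfSum                                                   ≈⟨ ≋-∑-cong h term ⟩
      ∑ h (λ i → ε * + 9 * X ^ suc q * oddTerm h i)             ≡⟨ ∑-distribˡ-* (ε * + 9 * X ^ suc q) h (oddTerm h) ⟩
      ε * + 9 * X ^ suc q * oddSum h                            ∎
      where
      open ≋-Reasoning
      rearrange : ∀ ε t c u v → ε * + 9 * t * c * (u * v) ≡ ε * + 9 * u * (c * (t * v))
      rearrange = solve-∀
      term : ∀ {i} → i ℕ.< h → + ((3 ℕ.* (suc q ℕ.+ i)) C (suc q ℕ.+ i)) * X ^ (suc q ℕ.+ i)
                             ≋ ε * + 9 * X ^ suc q * oddTerm h i
      term {i} i<h = begin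
        + ((3 ℕ.* (suc q ℕ.+ i)) C (suc q ℕ.+ i)) * X ^ (suc q ℕ.+ i)
          ≈⟨ ≋-*-cong (C[3k,k]≋ i<h) (≋-refl {X ^ (suc q ℕ.+ i)}) ⟩
        ε * + 9 * (- + 27) ^ i * Y * X ^ (suc q ℕ.+ i)
          ≡⟨ cong (ε * + 9 * (- + 27) ^ i * Y *_) (^-distribˡ-+-* X (suc q) i) ⟩
        ε * + 9 * (- + 27) ^ i * Y * (X ^ suc q * X ^ i)
          ≡⟨ rearrange ε ((- + 27) ^ i) Y (X ^ suc q) (X ^ i) ⟩
        ε * + 9 * X ^ suc q * (Y * ((- + 27) ^ i * X ^ i))
          ≡⟨ cong (λ x → ε * + 9 * X ^ suc q * (Y * x)) (^-distribʳ-* (- + 27) X i) ⟨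
        ε * + 9 * X ^ suc q * oddTerm h i ∎
        where Y = + ((h ℕ.+ i) C suc (i ℕ.* 2))

    -- The exponent is (p + 1)/2, so the left side is z^(p+1) and Fermat's theorem applies.
    square-^ : ∀ z → (z * z) ^ suc q ≋ z * z
    square-^ z = begin
      (z * z) ^ suc q            ≡⟨ ^-distribʳ-* z z (suc q) ⟩
      z ^ suc q * z ^ suc q      ≡⟨ ^-distribˡ-+-* z (suc q) (suc q) ⟨
      z ^ (suc q ℕ.+ suc q)      ≡⟨ cong (z ^_) (trans (double q) (cong suc (sym p≡1+2q))) ⟩
      z * z ^ p                  ≈⟨ ≋-*-cong (≋-refl {z}) (fermatℤ z) ⟩
      z * z                      ∎
      where
      open ≋-Reasoning
      double : ∀ q → suc q ℕ.+ suc q ≡ suc (suc (q ℕ.* 2))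
      double = ℕ-Solver.solve-∀

    module _ (9NX≋4 : + 9 * N * X ≋ + 4) where

      N*y≋-12 : N * y ≋ - + 12
      N*y≋-12 = *-cancelˡ (Unit-* Unit-3 Unit-3) (begin
        + 9 * (N * y)              ≡⟨ rearrange N X ⟩
        - + 27 * (+ 9 * N * X)     ≈⟨ ≋-*-cong (≋-refl { - + 27}) 9NX≋4 ⟩
        - + 27 * + 4               ∎)
        where
        open ≋-Reasoning
        rearrange : ∀ N X → + 9 * (N * (- + 27 * X)) ≡ - + 27 * (+ 9 * N * X)
        rearrange = solve-∀

      -- Raise 9NX ≡ 4 to the power (p + 1)/2: the squares 9 and 4 are fixed by that power, while N
      -- and X keep their exponent.
      N^*9X^≋4 : N ^ suc q * (+ 9 * X ^ suc q) ≋ + 4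
      N^*9X^≋4 = begin
        N ^ suc q * (+ 9 * X ^ suc q)              ≡⟨ rearrange (N ^ suc q) (+ 9) (X ^ suc q) ⟩
        + 9 * N ^ suc q * X ^ suc q                ≈⟨ ≋-*-cong (≋-*-cong (square-^ (+ 3)) (≋-refl {N ^ suc q})) (≋-refl {X ^ suc q}) ⟨
        (+ 9) ^ suc q * N ^ suc q * X ^ suc q      ≡⟨ cong (_* X ^ suc q) (^-distribʳ-* (+ 9) N (suc q)) ⟨
        (+ 9 * N) ^ suc q * X ^ suc q              ≡⟨ ^-distribʳ-* (+ 9 * N) X (suc q) ⟨
        (+ 9 * N * X) ^ suc q                      ≈⟨ ≋-^-cong (suc q) 9NX≋4 ⟩
        (+ 4) ^ suc q                              ≈⟨ square-^ (+ 2) ⟩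
        + 4                                        ∎
        where
        open ≋-Reasoning
        rearrange : ∀ x y z → x * (y * z) ≡ y * x * z
        rearrange = solve-∀

      N^*sum≋ : N ^ suc q * (a * halfSum) ≋ ε * (+ 4 * a * oddSum h)
      N^*sum≋ = begin
        N ^ suc q * (a * halfSum)
          ≈⟨ ≋-*-cong (≋-refl {N ^ suc q}) (≋-*-cong (≋-refl {a}) halfSum≋) ⟩
        N ^ suc q * (a * (ε * + 9 * X ^ suc q * oddSum h))
          ≡⟨ rearrange (N ^ suc q) a ε (+ 9) (X ^ suc q) (oddSum h) ⟩
        N ^ suc q * (+ 9 * X ^ suc q) * (ε * a * oddSum h)
          ≈⟨ ≋-*-cong N^*9X^≋4 (≋-refl {ε * a * oddSum h}) ⟩
        + 4 * (ε * a * oddSum h)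
          ≡⟨ rearrange′ (+ 4) ε a (oddSum h) ⟩
        ε * (+ 4 * a * oddSum h) ∎
        where
        open ≋-Reasoning
        rearrange : ∀ n c e k x f → n * (c * (e * k * x * f)) ≡ n * (k * x) * (e * c * f)
        rearrange = solve-∀
        rearrange′ : ∀ k e c f → k * (e * c * f) ≡ e * (k * c * f)
        rearrange′ = solve-∀

      module _ (π : ℤω) (π∣p : π ∣ω embed (+ p)) where
        open Modω p p-prime π π∣p

        private
          α = eisenstein (a + 1ℤ) (+ 2)
          β = conj α

        αβ≡N : α *ω β ≡ embed N
        αβ≡N = cong₂ eisenstein (real a) (imaginary a)
          where
          real : ∀ a → (a + 1ℤ) * (a + 1ℤ - + 2) - + 2 * - + 2 ≡ a * a + + 3
          real = solve-∀
          imaginary : ∀ a → (a + 1ℤ) * - + 2 + + 2 * (a + 1ℤ - + 2) - + 2 * - + 2 ≡ 0ℤ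
          imaginary = solve-∀

        private
          [α-β]²≡-12 : (α -ω β) *ω (α -ω β) ≡ embed (- + 12)
          [α-β]²≡-12 = cong (λ x → x *ω x) (cong (λ x → eisenstein x (+ 4)) (real a))
            where
            real : ∀ a → a + 1ℤ + - (a + 1ℤ - + 2) ≡ + 2
            real = solve-∀

          -- This is where the factor c of the theorem is absorbed: 4a √-3 is the multiplier that
          -- `oddSum-closed` asks for.
          α²-β²≡ : α *ω α -ω β *ω β ≡ embed (+ 4 * a) *ω √-3
          α²-β²≡ = cong₂ eisenstein (real a) (imaginary a)
            where
            real : ∀ a → ((a + 1ℤ) * (a + 1ℤ) - + 2 * + 2) + - ((a + 1ℤ - + 2) * (a + 1ℤ - + 2) - - + 2 * - + 2)
              ≡ + 4 * a * + 1 - 0ℤ * + 2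
            real = solve-∀
            imaginary : ∀ a → ((a + 1ℤ) * + 2 + + 2 * (a + 1ℤ) - + 2 * + 2) + - ((a + 1ℤ - + 2) * - + 2 + - + 2 * (a + 1ℤ - + 2) - - + 2 * - + 2)
              ≡ + 4 * a * + 2 + 0ℤ * + 1 - 0ℤ * + 2
            imaginary = solve-∀

          αβy≋[α-β]² : α *ω β *ω embed y ≋ω (α -ω β) *ω (α -ω β)
          αβy≋[α-β]² = begin
            α *ω β *ω embed y          ≡⟨ cong (_*ω embed y) αβ≡N ⟩
            embed N *ω embed y         ≡⟨ embed-* N y ⟨
            embed (N * y)              ≈⟨ embed-≋ N*y≋-12 ⟩
            embed (- + 12)             ≡⟨ [α-β]²≡-12 ⟨
            (α -ω β) *ω (α -ω β)       ∎
            where open ≋ω-Reasoning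

        sum≋α^-β^ : (α *ω β) ^ω (suc q ℕ.+ h-1) *ω (√-3 *ω embed (a * halfSum))
                  ≋ω embed ε *ω (α ^ω (h ℕ.* 2) -ω β ^ω (h ℕ.* 2))
        sum≋α^-β^ = begin
          (α *ω β) ^ω (suc q ℕ.+ h-1) *ω (√-3 *ω S)
            ≡⟨ cong (_*ω (√-3 *ω S)) (^ω-+ (α *ω β) (suc q) h-1) ⟩
          (α *ω β) ^ω suc q *ω n *ω (√-3 *ω S)
            ≡⟨ cong (λ x → x *ω n *ω (√-3 *ω S)) (trans (cong (_^ω suc q) αβ≡N) (sym (embed-^ N (suc q)))) ⟩
          embed (N ^ suc q) *ω n *ω (√-3 *ω S)
            ≡⟨ rearrange (embed (N ^ suc q)) n √-3 S ⟩
          n *ω √-3 *ω (embed (N ^ suc q) *ω S)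
            ≡⟨ cong (n *ω √-3 *ω_) (embed-* (N ^ suc q) (a * halfSum)) ⟨
          n *ω √-3 *ω embed (N ^ suc q * (a * halfSum))
            ≈⟨ ≋ω-*-cong (≋ω-refl {n *ω √-3}) (embed-≋ N^*sum≋) ⟩
          n *ω √-3 *ω embed (ε * (+ 4 * a * oddSum h))
            ≡⟨ cong (n *ω √-3 *ω_) (trans (embed-* ε (+ 4 * a * oddSum h)) (cong (embed ε *ω_) (embed-* (+ 4 * a) (oddSum h)))) ⟩
          n *ω √-3 *ω (embed ε *ω (embed (+ 4 * a) *ω embed (oddSum h)))
            ≡⟨ rearrange′ n √-3 (embed ε) (embed (+ 4 * a)) (embed (oddSum h)) ⟩
          embed ε *ω (n *ω (embed (+ 4 * a) *ω √-3) *ω embed (oddSum h))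
            ≡⟨ cong (λ x → embed ε *ω (n *ω x *ω embed (oddSum h))) α²-β²≡ ⟨
          embed ε *ω (n *ω (α *ω α -ω β *ω β) *ω embed (oddSum h))
            ≈⟨ ≋ω-*-cong (≋ω-refl {embed ε}) (ClosedForms.oddSum-closed π α β y αβy≋[α-β]² h-1) ⟩
          embed ε *ω (α ^ω (h ℕ.* 2) -ω β ^ω (h ℕ.* 2)) ∎
          where
          open ≋ω-Reasoning
          S = embed (a * halfSum)
          n = (α *ω β) ^ω h-1
          rearrange : ∀ x n d s → x *ω n *ω (d *ω s) ≡ n *ω d *ω (x *ω s)
          rearrange = solveω-∀ ωring
          rearrange′ : ∀ n d e c f → n *ω d *ω (e *ω (c *ω f)) ≡ e *ω (n *ω (c *ω d) *ω f)
          rearrange′ = solveω-∀ ωring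

  -- Conjugation and norm.

  conj-involutive : ∀ x → conj (conj x) ≡ x
  conj-involutive x = cong₂ eisenstein (real (re x) (im x)) (imaginary (im x))
    where
    real : ∀ a b → a - b - - b ≡ a
    real = solve-∀
    imaginary : ∀ b → - - b ≡ b
    imaginary = solve-∀

  conj-* : ∀ x z → conj (x *ω z) ≡ conj x *ω conj z
  conj-* x z = cong₂ eisenstein (real (re x) (im x) (re z) (im z)) (imaginary (re x) (im x) (re z) (im z))
    where
    real : ∀ a b c d → a * c - b * d - (a * d + b * c - b * d) ≡ (a - b) * (c - d) - - b * - d
    real = solve-∀
    imaginary : ∀ a b c d → - (a * d + b * c - b * d) ≡ (a - b) * - d + - b * (c - d) - - b * - d
    imaginary = solve-∀

  conj-- : ∀ x z → conj (x -ω z) ≡ conj x -ω conj z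
  conj-- x z = cong₂ eisenstein (real (re x) (im x) (re z) (im z)) (imaginary (im x) (im z))
    where
    real : ∀ a b c d → a + - c - (b + - d) ≡ a - b + - (c - d)
    real = solve-∀
    imaginary : ∀ b d → - (b + - d) ≡ - b + - - d
    imaginary = solve-∀

  conj-^ : ∀ x n → conj (x ^ω n) ≡ conj x ^ω n
  conj-^ x zero    = refl
  conj-^ x (suc n) = trans (conj-* x (x ^ω n)) (cong (conj x *ω_) (conj-^ x n))

  conj-embed : ∀ a → conj (embed a) ≡ embed a
  conj-embed a = cong embed (real a)
    where
    real : ∀ a → a - 0ℤ ≡ a
    real = solve-∀

  -- Transports the character condition at `conj π` to a congruence modulo π, where both characters
  -- can be combined.
  conj-∣ω : ∀ {π x} → conj π ∣ω x → π ∣ω conj x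
  conj-∣ω {π} (γ , refl) = conj γ , trans (conj-* (conj π) γ) (cong (_*ω conj γ) (conj-involutive π))

  x*conj[x]≡Nω[x] : ∀ x → x *ω conj x ≡ embed (Nω x)
  x*conj[x]≡Nω[x] x = cong₂ eisenstein (real (re x) (im x)) (imaginary (re x) (im x))
    where
    real : ∀ a b → a * (a - b) - b * - b ≡ a * a - a * b + b * b
    real = solve-∀
    imaginary : ∀ a b → a * - b + b * (a - b) - b * - b ≡ 0ℤ
    imaginary = solve-∀

  -- ω^j - ω^(-j) = residue j · √-3 for j = 0, 1, 2.
  residue : ℕ → ℤ
  residue 0 = 0ℤ
  residue 1 = 1ℤ
  residue _ = - 1ℤ

  -- Cubic characters, and descent from π to p.

  module _ (p : ℕ) (p-prime : Prime p) where
    open Modℤ p p-prime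

    embed-p∣embed⇒Multiple : ∀ {z} → embed (+ p) ∣ω embed z → Multiple z
    embed-p∣embed⇒Multiple {z} (γ , z≡pγ) = re γ , trans (cong re z≡pγ) (real (+ p) (re γ) (im γ))
      where
      real : ∀ p a b → p * a - 0ℤ * b ≡ p * a
      real = solve-∀

    -- Multiplying z = πγ by its conjugate gives z² = p · γ · `conj γ`, so p divides z² and hence z.
    π∣embed⇒Multiple : ∀ {π z} → π *ω conj π ≡ embed (+ p) → π ∣ω embed z → Multiple z
    π∣embed⇒Multiple {π} {z} ππ̄≡p (γ , z≡πγ) = [ id , id ]′ (Multiple-prime z z (embed-p∣embed⇒Multiple (γ *ω conj γ , (begin
      embed (z * z)                        ≡⟨ embed-* z z ⟩
      embed z *ω embed z                   ≡⟨ cong (embed z *ω_) (conj-embed z) ⟨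
      embed z *ω conj (embed z)            ≡⟨ cong (λ x → x *ω conj x) z≡πγ ⟩
      π *ω γ *ω conj (π *ω γ)              ≡⟨ cong (π *ω γ *ω_) (conj-* π γ) ⟩
      π *ω γ *ω (conj π *ω conj γ)         ≡⟨ interchange π γ (conj π) (conj γ) ⟩
      π *ω conj π *ω (γ *ω conj γ)         ≡⟨ cong (_*ω (γ *ω conj γ)) ππ̄≡p ⟩
      embed (+ p) *ω (γ *ω conj γ)         ∎))))
      where
      open ≡-Reasoning
      interchange : ∀ a b c d → a *ω b *ω (c *ω d) ≡ a *ω c *ω (b *ω d)
      interchange = solveω-∀ ωring

    module CubicCharacter (π : ℤω) (π∣p : π ∣ω embed (+ p)) where
      open Modω p p-prime π π∣p

      -- The character is stated with the denominator b of c cleared. Since `shiftNum c` ≡ b(a +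
      -- √-3), the unit b^e can be cancelled.
      CubicChar⇒≋ : ∀ {c a} j → ↧ c * a ≋ ↥ c → Unit (↧ c) → CubicChar π (shiftNum c) (↧ c) j →
        (eisenstein (a + 1ℤ) (+ 2)) ^ω ((∣ Nω π ∣ ℕ.∸ 1) ℕ./ 3) ≋ω ω ^ω toℕ j
      CubicChar⇒≋ {c} {a} j ba≋u unit-b char = embed-cancelˡ (Unit-^ e unit-b) (begin
        embed (b ^ e) *ω α ^ω e          ≡⟨ cong (_*ω α ^ω e) (embed-^ b e) ⟩
        embed b ^ω e *ω α ^ω e           ≡⟨ ^ω-distrib-* (embed b) α e ⟨
        (embed b *ω α) ^ω e              ≈⟨ ≋ω-^-cong e bα≋ ⟩
        shiftNum c ^ω e                  ≈⟨ from-multipleω char ⟩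
        ω ^ω toℕ j *ω embed b ^ω e       ≡⟨ cong (ω ^ω toℕ j *ω_) (embed-^ b e) ⟨
        ω ^ω toℕ j *ω embed (b ^ e)      ≡⟨ commute (ω ^ω toℕ j) (embed (b ^ e)) ⟩
        embed (b ^ e) *ω ω ^ω toℕ j      ∎)
        where
        open ≋ω-Reasoning
        b = ↧ c
        e = (∣ Nω π ∣ ℕ.∸ 1) ℕ./ 3
        α = eisenstein (a + 1ℤ) (+ 2)
        commute : ∀ x z → x *ω z ≡ z *ω x
        commute = solveω-∀ ωring
        real : ∀ b a → b * (a + 1ℤ) - 0ℤ * + 2 ≡ b * a + b
        real = solve-∀
        imaginary : ∀ b a → b * + 2 + 0ℤ * (a + 1ℤ) - 0ℤ * + 2 ≡ 0ℤ + + 2 * b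
        imaginary = solve-∀
        bα≋ : embed b *ω α ≋ω shiftNum c
        bα≋ = begin
          embed b *ω α                            ≡⟨ cong₂ eisenstein (real b a) (imaginary b a) ⟩
          embed (b * a) +ω eisenstein b (+ 2 * b)       ≈⟨ ≋ω-+-cong (embed-≋ ba≋u) (≋ω-refl {eisenstein b (+ 2 * b)}) ⟩
          embed (↥ c) +ω eisenstein b (+ 2 * b)         ≡⟨ cong (eisenstein (↥ c + b)) (zero+ (+ 2 * b)) ⟩
          shiftNum c                              ∎
          where
          zero+ : ∀ x → 0ℤ + x ≡ x
          zero+ = solve-∀

      -- The common last step of both cases. The multiplier c₁ is chosen so that both sides become
      -- rational integers: -3 s on the left, -3 r on the right. The congruence then descends from π
      -- to p, and -3 is cancelled.
      extract : Unit (+ 3) → (∀ {z} → π ∣ω embed z → Multiple z) → ∀ {s r} c₁ c₂ {d} →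
        c₂ *ω (√-3 *ω embed s) ≋ω d → c₁ *ω c₂ *ω √-3 ≡ embed (- + 3) → c₁ *ω d ≡ embed (- + 3 * r) → s ≋ r
      extract unit-3 descend {s} {r} c₁ c₂ {d} c₂√-3s≋d c₁c₂√-3≡-3 c₁d≡-3r =
        *-cancelˡ { - + 3} (unit-3 ∘ Multiple-neg) (from-multiple (descend (to-multipleω (begin
          embed (- + 3 * s)                       ≡⟨ embed-* (- + 3) s ⟩
          embed (- + 3) *ω embed s                ≡⟨ cong (_*ω embed s) c₁c₂√-3≡-3 ⟨
          c₁ *ω c₂ *ω √-3 *ω embed s              ≡⟨ assoc c₁ c₂ √-3 (embed s) ⟩
          c₁ *ω (c₂ *ω (√-3 *ω embed s))          ≈⟨ ≋ω-*-cong (≋ω-refl {c₁}) c₂√-3s≋d ⟩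
          c₁ *ω d                                 ≡⟨ c₁d≡-3r ⟩
          embed (- + 3 * r)                       ∎))))
        where
        open ≋ω-Reasoning
        assoc : ∀ a b c d → a *ω b *ω c *ω d ≡ a *ω (b *ω (c *ω d))
        assoc = solveω-∀ ωring

  -- Primes p = 6h + 1, which split in ℤ[ω].

  module Split (h-1 : ℕ) (p-prime : Prime (suc (suc h-1 ℕ.* 6))) (p>3 : suc (suc h-1 ℕ.* 6) > 3) (a X : ℤ) where

    private
      h p : ℕ
      h = suc h-1
      p = suc (h ℕ.* 6)

      p≡6h+1 : + p ≡ + 6 * + h - - 1ℤ
      p≡6h+1 = trans (cong (λ x → 1ℤ + x) (pos-* h 6)) (rearrange (+ h))
        where
        rearrange : ∀ h → 1ℤ + h * + 6 ≡ + 6 * h - - 1ℤ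
        rearrange = solve-∀

      p≡1+2q : p ≡ suc (h ℕ.* 3 ℕ.* 2)
      p≡1+2q = cong suc (sym (ℕ.*-assoc h 3 2))

    open MainSum p p-prime p>3 (h ℕ.* 3) h-1 (- 1ℤ) p≡1+2q p≡6h+1 refl (ℕ.m≤m*n h 3) a X public

    module _ (9NX≋4 : + 9 * (a * a + + 3) * X ≋ + 4) (π : ℤω) (ππ̄≡p : π *ω conj π ≡ embed (+ p)) where
      private
        α = eisenstein (a + 1ℤ) (+ 2)
        β = conj α
        A = α ^ω (h ℕ.* 2)
        B = β ^ω (h ℕ.* 2)
        s = a * halfSum

        exponent : ∀ {x} → Nω x ≡ + p → (∣ Nω x ∣ ℕ.∸ 1) ℕ./ 3 ≡ h ℕ.* 2
        exponent Nx≡p rewrite Nx≡p = trans (cong (ℕ._/ 3) (sym (ℕ.*-assoc h 2 3))) (m*n/n≡m (h ℕ.* 2) 3)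

        Nπ≡p : Nω π ≡ + p
        Nπ≡p = cong re (trans (sym (x*conj[x]≡Nω[x] π)) ππ̄≡p)

        π̄π≡p : conj π *ω π ≡ embed (+ p)
        π̄π≡p = trans (commute (conj π) π) ππ̄≡p
          where
          commute : ∀ x z → x *ω z ≡ z *ω x
          commute = solveω-∀ ωring

        Nπ̄≡p : Nω (conj π) ≡ + p
        Nπ̄≡p = cong re (trans (sym (x*conj[x]≡Nω[x] (conj π))) (trans (cong (conj π *ω_) (conj-involutive π)) π̄π≡p))

        π∣p : π ∣ω embed (+ p)
        π∣p = conj π , sym ππ̄≡p

        π̄∣p : conj π ∣ω embed (+ p)
        π̄∣p = π , sym π̄π≡p

      open Modω p p-prime π π∣p

      module _ {c} (ba≋u : ↧ c * a ≋ ↥ c) (unit-b : Unit (↧ c)) where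

        split-sum : ∀ i k → CubicChar π (shiftNum c) (↧ c) i → CubicChar (conj π) (shiftNum c) (↧ c) k →
          s ≋ residue ((toℕ i ℕ.+ toℕ k) ℕ.% 3)
        split-sum i k char charbar =
          CubicCharacter.extract p p-prime π π∣p Unit-3 (π∣embed⇒Multiple p p-prime {π} ππ̄≡p)
            -- With c₂ = (uv)², the multiplier √-3 · uv completes the cube (uv)³ = 1 and the square
            -- (√-3)² = -3.
            (√-3 *ω (u *ω v)) (u *ω v *ω (u *ω v)) (begin
              u *ω v *ω (u *ω v) *ω (√-3 *ω embed s)
                ≈⟨ ≋ω-*-cong (≋ω-*-cong AB≋uv AB≋uv) (≋ω-refl {√-3 *ω embed s}) ⟨
              A *ω B *ω (A *ω B) *ω (√-3 *ω embed s)
                ≡⟨ cong (_*ω (√-3 *ω embed s)) power ⟨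
              (α *ω β) ^ω (suc (h ℕ.* 3) ℕ.+ h-1) *ω (√-3 *ω embed s)
                ≈⟨ sum≋α^-β^ 9NX≋4 π π∣p ⟩
              embed (- 1ℤ) *ω (A -ω B)
                ≈⟨ ≋ω-*-cong (≋ω-refl {embed (- 1ℤ)}) (≋ω-+-cong A≋u (≋ω-neg-cong B≋v)) ⟩
              embed (- 1ℤ) *ω (u -ω v) ∎)
            (scale i k) (value i k)
          where
          open ≋ω-Reasoning
          u = ω ^ω toℕ i
          v = conj (ω ^ω toℕ k)
          A≋u : A ≋ω u
          A≋u = subst (λ e → α ^ω e ≋ω u) (exponent {π} Nπ≡p)
            (CubicCharacter.CubicChar⇒≋ p p-prime π π∣p {c} {a} i ba≋u unit-b char)
          -- Conjugating α^(2h) ≡ ω^k modulo `conj π` gives β^(2h) ≡ ω^(-k) modulo π.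
          B≋v : B ≋ω v
          B≋v = from-multipleω (Multipleω-resp
            (trans (cong (_-ω v) (sym (conj-^ α (h ℕ.* 2)))) (sym (conj-- (α ^ω (h ℕ.* 2)) (ω ^ω toℕ k))))
            (conj-∣ω {π} (subst (λ e → conj π ∣ω (α ^ω e -ω ω ^ω toℕ k)) (exponent {conj π} Nπ̄≡p)
              (Quotient.to-multiple
                (CubicCharacter.CubicChar⇒≋ p p-prime (conj π) π̄∣p {c} {a} k ba≋u unit-b charbar)))))
          AB≋uv : A *ω B ≋ω u *ω v
          AB≋uv = ≋ω-*-cong A≋u B≋v
          -- Here (p - 1)/2 + h = 3h + h, which is twice the exponent 2h of A and B.
          power : (α *ω β) ^ω (suc (h ℕ.* 3) ℕ.+ h-1) ≡ A *ω B *ω (A *ω B)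
          power = trans (cong ((α *ω β) ^ω_) (index h-1))
            (trans (^ω-+ (α *ω β) (h ℕ.* 2) (h ℕ.* 2)) (cong (λ x → x *ω x) (^ω-distrib-* α β (h ℕ.* 2))))
            where
            index : ∀ n → suc (suc n ℕ.* 3) ℕ.+ n ≡ suc n ℕ.* 2 ℕ.+ suc n ℕ.* 2
            index = ℕ-Solver.solve-∀
          scale : ∀ i k → let w = ω ^ω toℕ i *ω conj (ω ^ω toℕ k) in √-3 *ω w *ω (w *ω w) *ω √-3 ≡ embed (- + 3)
          scale 0F 0F = refl
          scale 0F 1F = refl
          scale 0F 2F = refl
          scale 1F 0F = refl
          scale 1F 1F = refl
          scale 1F 2F = refl
          scale 2F 0F = refl
          scale 2F 1F = refl
          scale 2F 2F = refl
          -- Since ω³ = 1, -uv(u - v) = uv² - u²v = ω^(i+k) - ω^(-(i+k)), so only the sum i + k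
          -- modulo 3 survives, as in the cubic Jacobi symbol.
          value : ∀ i k → let u = ω ^ω toℕ i ; v = conj (ω ^ω toℕ k) in
            √-3 *ω (u *ω v) *ω (embed (- 1ℤ) *ω (u -ω v)) ≡ embed (- + 3 * residue ((toℕ i ℕ.+ toℕ k) ℕ.% 3))
          value 0F 0F = refl
          value 0F 1F = refl
          value 0F 2F = refl
          value 1F 0F = refl
          value 1F 1F = refl
          value 1F 2F = refl
          value 2F 0F = refl
          value 2F 1F = refl
          value 2F 2F = refl

  -- Primes p = 6h - 1, which stay prime in ℤ[ω].

  module Inert (h-1 : ℕ) (p-prime : Prime (5 ℕ.+ h-1 ℕ.* 6)) (p>3 : 5 ℕ.+ h-1 ℕ.* 6 > 3) (a X : ℤ) where

    private
      h p q : ℕ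
      h = suc h-1
      p = 5 ℕ.+ h-1 ℕ.* 6
      q = 2 ℕ.+ h-1 ℕ.* 3

      p≡6h-1 : + p ≡ + 6 * + h - 1ℤ
      p≡6h-1 = trans (cong (λ x → + 5 + x) (pos-* h-1 6)) (rearrange (+ h-1))
        where
        rearrange : ∀ n → + 5 + n * + 6 ≡ + 6 * (1ℤ + n) - 1ℤ
        rearrange = solve-∀

      p≡1+2q : p ≡ suc (q ℕ.* 2)
      p≡1+2q = identity h-1
        where
        identity : ∀ n → 5 ℕ.+ n ℕ.* 6 ≡ suc ((2 ℕ.+ n ℕ.* 3) ℕ.* 2)
        identity = ℕ-Solver.solve-∀

      h≤q : h ℕ.≤ q
      h≤q = s≤s (ℕ.≤-trans (ℕ.m≤m*n h-1 3) (ℕ.n≤1+n _))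

    open MainSum p p-prime p>3 q h-1 1ℤ p≡1+2q p≡6h-1 refl h≤q a X public

    module _ (9NX≋4 : + 9 * (a * a + + 3) * X ≋ + 4) (unit-N : Unit (a * a + + 3)) where
      private
        π = embed (+ p)
        N = a * a + + 3
        α = eisenstein (a + 1ℤ) (+ 2)
        β = conj α
        A = α ^ω (h ℕ.* 2)
        B = β ^ω (h ℕ.* 2)
        s = a * halfSum

        one : ∀ x → x ≡ x *ω 1ω
        one = solveω-∀ ωring

        π∣p : π ∣ω embed (+ p)
        π∣p = 1ω , one (embed (+ p))

        -- From p² - 1 = (p + 1)(p - 1) and p + 1 = 6h, the exponent is 2h(p - 1).
        exponent : (∣ Nω π ∣ ℕ.∸ 1) ℕ./ 3 ≡ h ℕ.* 2 ℕ.* (4 ℕ.+ h-1 ℕ.* 6)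
        exponent = begin
          (∣ Nω π ∣ ℕ.∸ 1) ℕ./ 3                                  ≡⟨ cong (λ z → (∣ z ∣ ℕ.∸ 1) ℕ./ 3) (norm (+ p)) ⟩
          (∣ + p * + p ∣ ℕ.∸ 1) ℕ./ 3                             ≡⟨ cong (λ z → (∣ z ∣ ℕ.∸ 1) ℕ./ 3) (pos-* p p) ⟨
          (p ℕ.* p ℕ.∸ 1) ℕ./ 3                                   ≡⟨ cong (λ n → (n ℕ.∸ 1) ℕ./ 3) (square h-1) ⟩
          (h ℕ.* 2 ℕ.* (4 ℕ.+ h-1 ℕ.* 6) ℕ.* 3) ℕ./ 3             ≡⟨ m*n/n≡m _ 3 ⟩
          h ℕ.* 2 ℕ.* (4 ℕ.+ h-1 ℕ.* 6)                           ∎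
          where
          open ≡-Reasoning
          norm : ∀ p → p * p - p * 0ℤ + 0ℤ * 0ℤ ≡ p * p
          norm = solve-∀
          square : ∀ n → (5 ℕ.+ n ℕ.* 6) ℕ.* (5 ℕ.+ n ℕ.* 6) ≡ suc (suc n ℕ.* 2 ℕ.* (4 ℕ.+ n ℕ.* 6) ℕ.* 3)
          square = ℕ-Solver.solve-∀

      open Modω p p-prime π π∣p

      private
        ω^p≡ω² : ω ^ω p ≡ ω *ω ω
        ω^p≡ω² = trans (^ω-+ ω 5 (h-1 ℕ.* 6)) (trans (cong (ω ^ω 5 *ω_) (trans (sym (^ω-assoc ω 6 h-1)) (1^ h-1))) refl)
          where
          1^ : ∀ n → (ω ^ω 6) ^ω n ≡ 1ω
          1^ zero    = refl
          1^ (suc n) = cong (1ω *ω_) (1^ n)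

        -- Frobenius fixes the rational integers a + 1 and 2 and sends ω to ω², because p ≡ 5 modulo
        -- 6; thus it acts as conjugation.
        α^p≋β : α ^ω p ≋ω β
        α^p≋β = begin
          α ^ω p                                         ≡⟨ cong (_^ω p) (cong₂ eisenstein (real a) refl) ⟩
          (x +ω z) ^ω p                                  ≡⟨ ^′≡^ω (x +ω z) p ⟨
          (x +ω z) ^′ p                                  ≈⟨ frobenius-+ p-prime p×1≋0 x z ⟩
          x ^′ p +ω z ^′ p                               ≡⟨ cong₂ _+ω_ (^′≡^ω x p) (^′≡^ω z p) ⟩
          x ^ω p +ω z ^ω p                               ≡⟨ cong₂ _+ω_ (sym (embed-^ (a + 1ℤ) p)) z^p ⟩
          embed ((a + 1ℤ) ^ p) +ω embed ((+ 2) ^ p) *ω (ω *ω ω)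
            ≈⟨ ≋ω-+-cong (embed-≋ (fermatℤ (a + 1ℤ))) (≋ω-*-cong (embed-≋ (fermatℤ (+ 2))) (≋ω-refl {ω *ω ω})) ⟩
          embed (a + 1ℤ) +ω embed (+ 2) *ω (ω *ω ω)      ∎
          where
          open ≋ω-Reasoning
          open Frobenius quotientRingω using (frobenius-+) renaming (_^_ to _^′_; _×_ to _×′_)
          x = embed (a + 1ℤ)
          z = embed (+ 2) *ω ω
          real : ∀ a → a + 1ℤ ≡ a + 1ℤ + 0ℤ
          real = solve-∀
          ^′≡^ω : ∀ x n → x ^′ n ≡ x ^ω n
          ^′≡^ω x zero    = refl
          ^′≡^ω x (suc n) = cong (x *ω_) (^′≡^ω x n)
          ×1≡embed : ∀ n → n ×′ 1ω ≡ embed (+ n)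
          ×1≡embed zero    = refl
          ×1≡embed (suc n) = cong (1ω +ω_) (×1≡embed n)
          p×1≋0 : p ×′ 1ω ≋ω embed 0ℤ
          p×1≋0 = from-multipleω (Multipleω-resp (trans (cong (_-ω embed 0ℤ) (×1≡embed p)) (minus-0 (embed (+ p)))) π∣p)
            where
            minus-0 : ∀ x → x -ω embed 0ℤ ≡ x
            minus-0 = solveω-∀ ωring
          z^p : z ^ω p ≡ embed ((+ 2) ^ p) *ω (ω *ω ω)
          z^p = trans (^ω-distrib-* (embed (+ 2)) ω p) (cong₂ _*ω_ (sym (embed-^ (+ 2) p)) ω^p≡ω²)

        -- The exponent 6h is p + 1, so the cube of A is α · α^p.
        A³≋αβ : A *ω A *ω A ≋ω α *ω β
        A³≋αβ = begin
          A *ω A *ω A                                ≡⟨ cong (_*ω A) (^ω-+ α (h ℕ.* 2) (h ℕ.* 2)) ⟨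
          α ^ω (h ℕ.* 2 ℕ.+ h ℕ.* 2) *ω A            ≡⟨ ^ω-+ α (h ℕ.* 2 ℕ.+ h ℕ.* 2) (h ℕ.* 2) ⟨
          α ^ω (h ℕ.* 2 ℕ.+ h ℕ.* 2 ℕ.+ h ℕ.* 2)     ≡⟨ cong (α ^ω_) (index h-1) ⟩
          α *ω α ^ω p                                ≈⟨ ≋ω-*-cong (≋ω-refl {α}) α^p≋β ⟩
          α *ω β                                     ∎
          where
          open ≋ω-Reasoning
          index : ∀ n → suc n ℕ.* 2 ℕ.+ suc n ℕ.* 2 ℕ.+ suc n ℕ.* 2 ≡ suc (5 ℕ.+ n ℕ.* 6)
          index = ℕ-Solver.solve-∀

      module _ {c} (ba≋u : ↧ c * a ≋ ↥ c) (unit-b : Unit (↧ c)) where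

        inert-sum : ∀ j → CubicChar π (shiftNum c) (↧ c) j → s ≋ residue (toℕ j)
        inert-sum j char =
          CubicCharacter.extract p p-prime π π∣p Unit-3 (embed-p∣embed⇒Multiple p p-prime)
            (√-3 *ω w) (w *ω w) (embed-cancelˡ (Unit-^ (suc (h ℕ.* 2)) unit-N) cancelled) (scale j) (value j)
          where
          open ≋ω-Reasoning
          w = ω ^ω toℕ j
          S = √-3 *ω embed s
          -- The division-free form of (β/α)^(2h) ≡ w: β^(2h) ≡ α^(2hp), and 2hp is the character
          -- exponent 2h(p - 1) plus 2h.
          B≋wA : B ≋ω w *ω A
          B≋wA = begin
            B                                                        ≈⟨ ≋ω-^-cong (h ℕ.* 2) α^p≋β ⟨
            (α ^ω p) ^ω (h ℕ.* 2)                                    ≡⟨ ^ω-assoc α p (h ℕ.* 2) ⟩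
            α ^ω (h ℕ.* 2 ℕ.* p)                                     ≡⟨ cong (α ^ω_) (index h-1) ⟩
            α ^ω (h ℕ.* 2 ℕ.* (4 ℕ.+ h-1 ℕ.* 6) ℕ.+ h ℕ.* 2)         ≡⟨ ^ω-+ α (h ℕ.* 2 ℕ.* (4 ℕ.+ h-1 ℕ.* 6)) (h ℕ.* 2) ⟩
            α ^ω (h ℕ.* 2 ℕ.* (4 ℕ.+ h-1 ℕ.* 6)) *ω A                ≈⟨ ≋ω-*-cong α^e≋w (≋ω-refl {A}) ⟩
            w *ω A                                                   ∎
            where
            index : ∀ n → suc n ℕ.* 2 ℕ.* (5 ℕ.+ n ℕ.* 6) ≡ suc n ℕ.* 2 ℕ.* (4 ℕ.+ n ℕ.* 6) ℕ.+ suc n ℕ.* 2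
            index = ℕ-Solver.solve-∀
            α^e≋w : α ^ω (h ℕ.* 2 ℕ.* (4 ℕ.+ h-1 ℕ.* 6)) ≋ω w
            α^e≋w = subst (λ e → α ^ω e ≋ω w) exponent
              (CubicCharacter.CubicChar⇒≋ p p-prime π π∣p {c} {a} j ba≋u unit-b char)
          power : α *ω β *ω (α *ω β) ^ω (suc q ℕ.+ h-1) ≡ A *ω B *ω (A *ω B)
          power = trans (cong ((α *ω β) ^ω_) (index h-1))
            (trans (^ω-+ (α *ω β) (h ℕ.* 2) (h ℕ.* 2)) (cong (λ x → x *ω x) (^ω-distrib-* α β (h ℕ.* 2))))
            where
            index : ∀ n → suc (suc (2 ℕ.+ n ℕ.* 3) ℕ.+ n) ≡ suc n ℕ.* 2 ℕ.+ suc n ℕ.* 2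
            index = ℕ-Solver.solve-∀
          -- The power of αβ in `sum≋α^-β^` has exponent 4h - 1 here. One more factor makes it (AB)²
          -- ≡ A⁴w² ≡ αβ A w², so both sides acquire the common factor αβ A.
          multiplied : α *ω β *ω (A *ω (w *ω w *ω S)) ≋ω α *ω β *ω (A *ω (1ω -ω w))
          multiplied = begin
            α *ω β *ω (A *ω (w *ω w *ω S))
              ≈⟨ ≋ω-*-cong A³≋αβ (≋ω-refl {A *ω (w *ω w *ω S)}) ⟨
            A *ω A *ω A *ω (A *ω (w *ω w *ω S))
              ≡⟨ rearrange₁ A w S ⟩
            A *ω (w *ω A) *ω (A *ω (w *ω A)) *ω S
              ≈⟨ ≋ω-*-cong (≋ω-*-cong (≋ω-*-cong (≋ω-refl {A}) B≋wA) (≋ω-*-cong (≋ω-refl {A}) B≋wA)) (≋ω-refl {S}) ⟨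
            A *ω B *ω (A *ω B) *ω S
              ≡⟨ cong (_*ω S) power ⟨
            α *ω β *ω (α *ω β) ^ω (suc q ℕ.+ h-1) *ω S
              ≡⟨ assoc (α *ω β) ((α *ω β) ^ω (suc q ℕ.+ h-1)) S ⟩
            α *ω β *ω ((α *ω β) ^ω (suc q ℕ.+ h-1) *ω S)
              ≈⟨ ≋ω-*-cong (≋ω-refl {α *ω β}) (sum≋α^-β^ 9NX≋4 π π∣p) ⟩
            α *ω β *ω (embed 1ℤ *ω (A -ω B))
              ≈⟨ ≋ω-*-cong (≋ω-refl {α *ω β}) (≋ω-*-cong (≋ω-refl {embed 1ℤ}) (≋ω-+-cong (≋ω-refl {A}) (≋ω-neg-cong B≋wA))) ⟩
            α *ω β *ω (1ω *ω (A -ω w *ω A))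
              ≡⟨ rearrange₂ (α *ω β) A w ⟩
            α *ω β *ω (A *ω (1ω -ω w)) ∎
            where
            rearrange₁ : ∀ A w S → A *ω A *ω A *ω (A *ω (w *ω w *ω S)) ≡ A *ω (w *ω A) *ω (A *ω (w *ω A)) *ω S
            rearrange₁ = solveω-∀ ωring
            assoc : ∀ x y z → x *ω y *ω z ≡ x *ω (y *ω z)
            assoc = solveω-∀ ωring
            rearrange₂ : ∀ n A w → n *ω (1ω *ω (A -ω w *ω A)) ≡ n *ω (A *ω (1ω -ω w))
            rearrange₂ = solveω-∀ ωring
          -- The common factor αβ A is not a rational integer; multiplying it by B makes it
          -- (αβ)^(2h+1) = N^(2h+1), which can be cancelled.
          norm-power : ∀ x → embed (N ^ suc (h ℕ.* 2)) *ω x ≡ B *ω (α *ω β *ω (A *ω x))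
          norm-power x = trans (cong (_*ω x) (trans (embed-^ N (suc (h ℕ.* 2)))
              (trans (cong (_^ω suc (h ℕ.* 2)) (sym (αβ≡N 9NX≋4 π π∣p))) (cong (α *ω β *ω_) (^ω-distrib-* α β (h ℕ.* 2))))))
            (rearrange (α *ω β) A B x)
            where
            rearrange : ∀ n A B x → n *ω (A *ω B) *ω x ≡ B *ω (n *ω (A *ω x))
            rearrange = solveω-∀ ωring
          cancelled : embed (N ^ suc (h ℕ.* 2)) *ω (w *ω w *ω S) ≋ω embed (N ^ suc (h ℕ.* 2)) *ω (1ω -ω w)
          cancelled = begin
            embed (N ^ suc (h ℕ.* 2)) *ω (w *ω w *ω S)     ≡⟨ norm-power (w *ω w *ω S) ⟩
            B *ω (α *ω β *ω (A *ω (w *ω w *ω S)))          ≈⟨ ≋ω-*-cong (≋ω-refl {B}) multiplied ⟩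
            B *ω (α *ω β *ω (A *ω (1ω -ω w)))              ≡⟨ norm-power (1ω -ω w) ⟨
            embed (N ^ suc (h ℕ.* 2)) *ω (1ω -ω w)         ∎
          scale : ∀ j → let w = ω ^ω toℕ j in √-3 *ω w *ω (w *ω w) *ω √-3 ≡ embed (- + 3)
          scale 0F = refl
          scale 1F = refl
          scale 2F = refl
          -- Since w² = w⁻¹, w(1 - w) = ω^j - ω^(-j), and the remaining √-3 makes it an integer.
          value : ∀ j → let w = ω ^ω toℕ j in √-3 *ω w *ω (1ω -ω w) ≡ embed (- + 3 * residue (toℕ j))
          value 0F = refl
          value 1F = refl
          value 2F = refl

  -- Primes modulo 6.

  even⊎odd : ∀ n → (∃ λ m → n ≡ m ℕ.* 2) ⊎ (∃ λ m → n ≡ suc (m ℕ.* 2))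
  even⊎odd zero    = inj₁ (0 , refl)
  even⊎odd (suc n) with even⊎odd n
  ... | inj₁ (m , refl) = inj₂ (m , refl)
  ... | inj₂ (m , refl) = inj₁ (suc m , refl)

  prime>3⇒≢2m : ∀ {p} → Prime p → p > 3 → ∀ m → p ≢ m ℕ.* 2
  prime>3⇒≢2m p-prime p>3 m refl with prime⇒irreducible p-prime (divides-refl m)
  ... | inj₂ 2≡p = contradiction (subst (_> 3) (sym 2≡p) p>3) (λ { (s≤s (s≤s ())) })

  -- Write p = 1 + 3t. An odd t makes p even and t = 0 gives p = 1, so t = 2h with h ≥ 1.
  prime%3≡1⇒6h+1 : ∀ {p} → Prime p → p > 3 → p ℕ.% 3 ≡ 1 → ∃ λ h-1 → p ≡ suc (suc h-1 ℕ.* 6)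
  prime%3≡1⇒6h+1 {p} p-prime p>3 p%3≡1 with p ℕ./ 3 | trans (m≡m%n+[m/n]*n p 3) (cong (ℕ._+ p ℕ./ 3 ℕ.* 3) p%3≡1)
  ... | t | p≡1+3t with even⊎odd t
  ...   | inj₁ (zero , refl)  = contradiction (subst (_> 3) p≡1+3t p>3) (λ { (s≤s ()) })
  ...   | inj₁ (suc m , refl) = m , trans p≡1+3t (cong suc (ℕ.*-assoc (suc m) 2 3))
  ...   | inj₂ (m , refl)     = contradiction (trans p≡1+3t (identity m)) (prime>3⇒≢2m p-prime p>3 (2 ℕ.+ m ℕ.* 3))
    where
    identity : ∀ m → 1 ℕ.+ suc (m ℕ.* 2) ℕ.* 3 ≡ (2 ℕ.+ m ℕ.* 3) ℕ.* 2
    identity = ℕ-Solver.solve-∀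

  prime%3≡2⇒6h-1 : ∀ {p} → Prime p → p > 3 → p ℕ.% 3 ≡ 2 → ∃ λ h-1 → p ≡ 5 ℕ.+ h-1 ℕ.* 6
  prime%3≡2⇒6h-1 {p} p-prime p>3 p%3≡2 with p ℕ./ 3 | trans (m≡m%n+[m/n]*n p 3) (cong (ℕ._+ p ℕ./ 3 ℕ.* 3) p%3≡2)
  ... | t | p≡2+3t with even⊎odd t
  ...   | inj₁ (m , refl) = contradiction (trans p≡2+3t (identity m)) (prime>3⇒≢2m p-prime p>3 (1 ℕ.+ m ℕ.* 3))
    where
    identity : ∀ m → 2 ℕ.+ m ℕ.* 2 ℕ.* 3 ≡ (1 ℕ.+ m ℕ.* 3) ℕ.* 2
    identity = ℕ-Solver.solve-∀
  ...   | inj₂ (m , refl) = m , trans p≡2+3t (cong (5 ℕ.+_) (ℕ.*-assoc m 2 3))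

  -- From the rational sum to an integer sum modulo p.

  module SumReduction (p : ℕ) (p-prime : Prime p) where
    open Modℤ p p-prime
    open Reduction p p-prime

    theSum-reduces : ∀ {q h} → (p ℕ.+ 1) ℕ./ 2 ≡ suc q → (2 ℕ.* p) ℕ./ 3 ≡ q ℕ.+ h → ∀ {c a t} →
      Reduces c a → + 9 * (a * a + + 3) * t ≋ 1ℤ →
      Reduces (theSum p c)
        (a * ∑ h (λ i → + ((3 ℕ.* (suc q ℕ.+ i)) C (suc q ℕ.+ i)) * (+ 4 * t) ^ (suc q ℕ.+ i)))
    theSum-reduces {q} {h} lo≡ hi≡ {c} {a} {t} red 9Nt≋1 = Reduces-* red
      (subst₂ (λ lo n → Reduces (sumFromTo ((p ℕ.+ 1) ℕ./ 2) ((2 ℕ.* p) ℕ./ 3) f) (∑ n (λ i → F (lo ℕ.+ i))))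
        lo≡ count (Reduces-sumFromTo ((p ℕ.+ 1) ℕ./ 2) ((2 ℕ.* p) ℕ./ 3) f F
          (λ k → Reduces-* (Reduces-/1 (+ ((3 ℕ.* k) C k))) (Reduces-^ x-reduces k))))
      where
      x : ℚ
      x = (+ 4 ℚ./ 1) ℚ.* inv ((+ 9 ℚ./ 1) ℚ.* (c ℚ.* c ℚ.+ (+ 3 ℚ./ 1)))
      f : ℕ → ℚ
      f k = (+ ((3 ℕ.* k) C k) ℚ./ 1) ℚ.* (x ^ℚ k)
      F : ℕ → ℤ
      F k = + ((3 ℕ.* k) C k) * (+ 4 * t) ^ k
      x-reduces : Reduces x (+ 4 * t)
      x-reduces = Reduces-* (Reduces-/1 (+ 4)) (Reduces-inv 9Nt≋1
        (Reduces-* (Reduces-/1 (+ 9)) (Reduces-+ (Reduces-* red red) (Reduces-/1 (+ 3)))))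
      -- The bounds q + 1 and q + h leave exactly h terms, matching `oddSum h`.
      count : suc ((2 ℕ.* p) ℕ./ 3) ℕ.∸ (p ℕ.+ 1) ℕ./ 2 ≡ h
      count = trans (cong₂ (λ hi lo → suc hi ℕ.∸ lo) hi≡ lo≡) (ℕ.m+n∸m≡n q h)

    record ReductionData (c : ℚ) : Set where
      field
        a t     : ℤ
        c≋a     : Reduces c a
        ba≋u    : ↧ c * a ≋ ↥ c
        unit-b  : Unit (↧ c)
        unit-N  : Unit (a * a + + 3)
        9Nt≋1   : + 9 * (a * a + + 3) * t ≋ 1ℤ
        9NX≋4   : + 9 * (a * a + + 3) * (+ 4 * t) ≋ + 4

    reductionData : Unit (+ 3) → ∀ c → InD p c → ¬ (c ℚ.* c ≡ ℚ.- (+ 3 ℚ./ 1) [modℚ p ]) → ReductionData c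
    reductionData unit-3 c inD c²≢-3 with v , bv≋1 ← inverse (InD⇒Unit-↧ {c} inD) = record
      { a = a ; t = t ; c≋a = c≋a ; ba≋u = ba≋u ; unit-b = InD⇒Unit-↧ {c} inD
      ; unit-N = unit-N ; 9Nt≋1 = 9Nt≋1 ; 9NX≋4 = 9NX≋4 }
      where
      open ≋-Reasoning
      a = ↥ c * v
      N = a * a + + 3
      c≋a : Reduces c a
      c≋a = Reduces-self c inD bv≋1
      swap : ∀ b u v → b * (u * v) ≡ b * v * u
      swap = solve-∀
      one : ∀ x → 1ℤ * x ≡ x
      one = solve-∀
      ba≋u : ↧ c * a ≋ ↥ c
      ba≋u = begin
        ↧ c * (↥ c * v)   ≡⟨ swap (↧ c) (↥ c) v ⟩
        ↧ c * v * ↥ c     ≈⟨ ≋-*-cong bv≋1 (≋-refl {↥ c}) ⟩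
        1ℤ * ↥ c          ≡⟨ one (↥ c) ⟩
        ↥ c               ∎
      unit-N : Unit N
      -- The double negation mirrors the shape c² - (-3) of the excluded congruence; on integers it
      -- computes away.
      unit-N mN = c²≢-3 (Reduces⇒∣ (Reduces-+ (Reduces-* c≋a c≋a) (Reduces-neg (Reduces-neg (Reduces-/1 (+ 3))))) mN)
      unit-9N : Unit (+ 9 * N)
      unit-9N = Unit-* (Unit-* unit-3 unit-3) unit-N
      t = proj₁ (inverse unit-9N)
      9Nt≋1 : + 9 * N * t ≋ 1ℤ
      9Nt≋1 = proj₂ (inverse unit-9N)
      pull : ∀ x t → x * (+ 4 * t) ≡ + 4 * (x * t)
      pull = solve-∀
      9NX≋4 : + 9 * N * (+ 4 * t) ≋ + 4
      9NX≋4 = begin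
        + 9 * N * (+ 4 * t)    ≡⟨ pull (+ 9 * N) t ⟩
        + 4 * (+ 9 * N * t)    ≈⟨ ≋-*-cong (≋-refl {+ 4}) 9Nt≋1 ⟩
        + 4                    ∎

  -- The value of the sum on each cubic class.

  module _ {p : ℕ} (p-prime : Prime p) (p>3 : p > 3) (c : ℚ) (inD : InD p c)
    (c²≢-3 : ¬ (c ℚ.* c ≡ ℚ.- (+ 3 ℚ./ 1) [modℚ p ])) where
    open Reduction p p-prime

    InC⇒theSum-reduces : ∀ {j} → InC p c j → Reduces (theSum p c) (residue (toℕ j))
    InC⇒theSum-reduces {j} (inj₁ (p%3≡2 , char)) with prime%3≡2⇒6h-1 p-prime p>3 p%3≡2
    ... | h-1 , refl = Reduces-≋
            (Inert.inert-sum h-1 p-prime p>3 a (+ 4 * t) 9NX≋4 unit-N {c} ba≋u unit-b j char)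
            (theSum-reduces lo≡ hi≡ c≋a 9Nt≋1)
      where
      open SumReduction p p-prime
      open ReductionData (reductionData (λ m → >⇒∤ p>3 (Modℤ.Multiple⇒p∣ p p-prime m)) c inD c²≢-3)
      lo≡ : (p ℕ.+ 1) ℕ./ 2 ≡ suc (2 ℕ.+ h-1 ℕ.* 3)
      lo≡ = trans (cong (ℕ._/ 2) (identity h-1)) (m*n/n≡m (3 ℕ.+ h-1 ℕ.* 3) 2)
        where
        identity : ∀ n → 5 ℕ.+ n ℕ.* 6 ℕ.+ 1 ≡ (3 ℕ.+ n ℕ.* 3) ℕ.* 2
        identity = ℕ-Solver.solve-∀
      hi≡ : (2 ℕ.* p) ℕ./ 3 ≡ 2 ℕ.+ h-1 ℕ.* 3 ℕ.+ suc h-1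
      hi≡ = trans (cong (ℕ._/ 3) (identity h-1))
        (trans (+-distrib-/-∣ʳ 1 {d = 3} (divides-refl (2 ℕ.+ h-1 ℕ.* 3 ℕ.+ suc h-1))) (m*n/n≡m (2 ℕ.+ h-1 ℕ.* 3 ℕ.+ suc h-1) 3))
        where
        identity : ∀ n → 2 ℕ.* (5 ℕ.+ n ℕ.* 6) ≡ 1 ℕ.+ (2 ℕ.+ n ℕ.* 3 ℕ.+ suc n) ℕ.* 3
        identity = ℕ-Solver.solve-∀
    InC⇒theSum-reduces {j} (inj₂ (p%3≡1 , π , _ , ππ̄≡p , i , k , char , charbar , i+k≡j)) with prime%3≡1⇒6h+1 p-prime p>3 p%3≡1
    ... | h-1 , refl = subst (λ n → Reduces (theSum p c) (residue n)) i+k≡j (Reduces-≋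
            (Split.split-sum h-1 p-prime p>3 a (+ 4 * t) 9NX≋4 π ππ̄≡p {c} ba≋u unit-b i k char charbar)
            (theSum-reduces lo≡ hi≡ c≋a 9Nt≋1))
      where
      open SumReduction p p-prime
      open ReductionData (reductionData (λ m → >⇒∤ p>3 (Modℤ.Multiple⇒p∣ p p-prime m)) c inD c²≢-3)
      lo≡ : (p ℕ.+ 1) ℕ./ 2 ≡ suc (suc h-1 ℕ.* 3)
      lo≡ = trans (cong (ℕ._/ 2) (identity h-1)) (m*n/n≡m (suc (suc h-1 ℕ.* 3)) 2)
        where
        identity : ∀ n → suc (suc n ℕ.* 6) ℕ.+ 1 ≡ suc (suc n ℕ.* 3) ℕ.* 2
        identity = ℕ-Solver.solve-∀
      hi≡ : (2 ℕ.* p) ℕ./ 3 ≡ suc h-1 ℕ.* 3 ℕ.+ suc h-1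
      hi≡ = trans (cong (ℕ._/ 3) (identity h-1))
        (trans (+-distrib-/-∣ʳ 2 {d = 3} (divides-refl (suc h-1 ℕ.* 3 ℕ.+ suc h-1))) (m*n/n≡m (suc h-1 ℕ.* 3 ℕ.+ suc h-1) 3))
        where
        identity : ∀ n → 2 ℕ.* suc (suc n ℕ.* 6) ≡ 2 ℕ.+ (suc n ℕ.* 3 ℕ.+ suc n) ℕ.* 3
        identity = ℕ-Solver.solve-∀

    theSum≡residue : ∀ j {r} → Reduces r (residue (toℕ j)) → InC p c j → theSum p c ≡ r [modℚ p ]
    theSum≡residue j r-reduces inC = Reduces⇒∣ (Reduces-+ (InC⇒theSum-reduces {j} inC) (Reduces-neg r-reduces))
      (to-multiple (≋-refl {residue (toℕ j)}))
      where open Modℤ p p-prime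

open import Data.Nat using (ℕ; _>_)
open import Data.Nat.Primality using (Prime)
open import Data.Rational using (ℚ; 0ℚ; 1ℚ; -_; _*_)
open import Data.Integer using (+_; 0ℤ; 1ℤ; -1ℤ)
open import Data.Rational using (_/_)
open import Data.Fin using (zero; suc)
open import Data.Product using (_×_; _,_)
open import Relation.Nullary using (¬_)
open CubicSums using (theSum≡residue; module Reduction)

theorem24 : (p : ℕ) → Prime p → p > 3 → (c : ℚ) → InD p c
    → ¬ (c * c ≡ - ((+ 3) / 1) [modℚ p ])
    → (InC p c zero → theSum p c ≡ 0ℚ [modℚ p ])
    × (InC p c (suc zero) → theSum p c ≡ 1ℚ [modℚ p ])
    × (InC p c (suc (suc zero)) → theSum p c ≡ - 1ℚ [modℚ p ])
theorem24 p p-prime p>3 c inD c²≢-3 =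
    -- The rational constants 0, 1 and -1 coincide by computation with the quotients n/1 that
    -- `Reduces-/1` handles, and the integers n with the values of `residue`.
    theSum≡residue p-prime p>3 c inD c²≢-3 zero (Reduces-/1 0ℤ)
  , theSum≡residue p-prime p>3 c inD c²≢-3 (suc zero) (Reduces-/1 1ℤ)
  , theSum≡residue p-prime p>3 c inD c²≢-3 (suc (suc zero)) (Reduces-/1 -1ℤ)
  where open Reduction p p-prime
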